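{- For every $n\ge 1$, let $\mathfrak{C}_n^o$ denote the set of cycles on $[n]$ in which the second entry of every drop is odd, and for a cycle $[\pi]$ let $\operatorname{drop}_{oo}([\pi])$ be its number of odd-odd drops. Then, as formal power series in $t$ with coefficients polynomial in $x$, $$\sum_{n\ge 1}\sum_{[\pi]\in\mathfrak{C}_n^o}x^{\operatorname{drop}_{oo}([\pi])}t^n = \sum_{m\ge 1}\frac{m!(m-1)!\,t^{2m}}{\prod_{k=1}^m \big(1+k^2(1-x)t^2\big)}+\sum_{m\ge 1}\frac{\big((m-1)!\big)^2t^{2m-1}}{\prod_{k=1}^m \big(1+k^2(1-x)t^2\big)}.$$
   Context: Let $\mathfrak{S}_n$ be the set of permutations of $[n]=\{1,\dots,n\}$, written as words $\pi=\pi_1\cdots\pi_n$. Two permutations are equivalent if one is a cyclic rotation of the other; a cycle $[\pi]$ on $[n]$ is an equivalence class, and $\mathfrak{C}_n$ is the set of cycles on $[n]$. Choose the representative with $\pi_1=1$ and read indices cyclically ($\pi_{n+1}=\pi_1$). A drop of $[\pi]$ is a pair $(\pi_i,\pi_{i+1})$, $1\le i\le n$, with $\pi_i>\pi_{i+1}$. A drop is odd-odd if both $\pi_i$ and $\pi_{i+1}$ are odd, and even-odd if $\pi_i$ is even and $\pi_{i+1}$ is odd. By convention, the unique cycle $[(1)]$ on $[1]$ has exactly one drop $(\star,1)$, where $\star$ is considered neither even nor odd (so this drop is neither odd-odd nor even-odd, but its second entry is odd). $\mathfrak{C}_n^o=\{[\pi]\in\mathfrak{C}_n:\ \pi_{i+1}\text{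 is odd for every drop }(\pi_i,\pi_{i+1})\text{ of }[\pi]\}$. -}

module Defs where

open import Data.Bool using (Bool; true; false; _∧_; _∨_; not; if_then_else_)
open import Data.Nat using (ℕ; zero; suc; _∸_; _<ᵇ_; _≡ᵇ_; _!) renaming (_+_ to _+ℕ_; _*_ to _*ℕ_)
open import Data.Nat.Base using (_%_)
open import Data.Integer using (ℤ; +_; _+_; _*_; -_)
open import Data.List using (List; []; _∷_; _++_; map; concatMap; zip; zipWith; length; filterᵇ; upTo; foldr)
open import Data.Product using (_×_; _,_)

range : ℕ → List ℕ
range n = map suc (upTo n)

words : ℕ → ℕ → List (List ℕ)
words n zero    = [] ∷ []
words n (suc k) = concatMap (λ v → map (v ∷_) (words n k)) (range n)

anyᵇ : {A : Set} → (A → Bool) → List A → Bool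
anyᵇ p []      = false
anyᵇ p (a ∷ w) = p a ∨ anyᵇ p w

allᵇ : {A : Set} → (A → Bool) → List A → Bool
allᵇ p []      = true
allᵇ p (a ∷ w) = p a ∧ allᵇ p w

elemᵇ : ℕ → List ℕ → Bool
elemᵇ v w = anyᵇ (λ u → u ≡ᵇ v) w

-- a word of length n over [1..n] is a permutation of [n] iff it contains every letter
isPermᵇ : ℕ → List ℕ → Bool
isPermᵇ n w = allᵇ (λ v → elemᵇ v w) (range n)

-- canonical representative of a cycle [π]: the rotation with π₁ = 1
startsWith1ᵇ : List ℕ → Bool
startsWith1ᵇ []      = false
startsWith1ᵇ (a ∷ _) = a ≡ᵇ 1

cycleReps : ℕ → List (List ℕ)
cycleReps n = filterᵇ (λ w → startsWith1ᵇ w ∧ isPermᵇ n w) (words n n)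

cyclicPairs : List ℕ → List (ℕ × ℕ)
cyclicPairs []       = []
cyclicPairs (a ∷ w)  = zip (a ∷ w) (w ++ (a ∷ []))

isDropᵇ : ℕ × ℕ → Bool
isDropᵇ (a , b) = b <ᵇ a

drops : List ℕ → List (ℕ × ℕ)
drops w = filterᵇ isDropᵇ (cyclicPairs w)

oddᵇ : ℕ → Bool
oddᵇ k = (k % 2) ≡ᵇ 1

inCoᵇ : List ℕ → Bool
inCoᵇ w = allᵇ (λ { (a , b) → oddᵇ b }) (drops w)

dropOO : List ℕ → ℕ
dropOO w = length (filterᵇ (λ { (a , b) → oddᵇ a ∧ oddᵇ b }) (drops w))

-- Algebraic side: formal power series in t with coefficients in ℤ[x]
-- An element of ℤ[x] (more generally ℤ[[x]]) is its coefficient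
-- function  ℕ → ℤ  (i ↦ coefficient of x^i); a power series in t over it
-- is  ℕ → (ℕ → ℤ)  (n ↦ coefficient of t^n).

sumTo : ℕ → (ℕ → ℤ) → ℤ
sumTo zero    f = f zero
sumTo (suc n) f = sumTo n f + f (suc n)

Poly : Set
Poly = ℕ → ℤ

P0 : Poly
P0 _ = + 0

Pconst : ℤ → Poly
Pconst c zero    = c
Pconst c (suc _) = + 0

oneMinusX : Poly
oneMinusX zero          = + 1
oneMinusX (suc zero)    = - (+ 1)
oneMinusX (suc (suc _)) = + 0

_+P_ : Poly → Poly → Poly
(p +P q) i = p i + q i

-P_ : Poly → Poly
(-P p) i = - (p i)

_*P_ : Poly → Poly → Poly
(p *P q) i = sumTo i (λ j → p j * q (i ∸ j))

sumP : List Poly → Poly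
sumP = foldr _+P_ P0

Series : Set
Series = ℕ → Poly

S1 : Series
S1 zero    = Pconst (+ 1)
S1 (suc _) = P0

_*S_ : Series → Series → Series
(f *S g) n = λ i → sumTo n (λ j → (f j *P g (n ∸ j)) i)

monomial : ℕ → ℤ → Series
monomial d c n = if n ≡ᵇ d then Pconst c else P0

-- Multiplicative inverse of a series a with constant term a₀ = 1:
-- b₀ = 1,  b_n = - Σ_{j=1}^{n} a_j b_{n-j}.
-- invRev a n = [b_n , b_{n-1} , … , b_0]
invRev : Series → ℕ → List Poly
invRev a zero    = Pconst (+ 1) ∷ []
invRev a (suc n) =
  (-P sumP (zipWith (λ j b → a (suc j) *P b) (upTo (suc n)) (invRev a n)))
  ∷ invRev a n

headP : List Poly → Poly
headP []      = P0
headP (p ∷ _) = p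

invS : Series → Series
invS a n = headP (invRev a n)

factorK : ℕ → Series
factorK k zero                = Pconst (+ 1)
factorK k (suc zero)          = P0
factorK k (suc (suc zero))    = Pconst (+ (k *ℕ k)) *P oneMinusX
factorK k (suc (suc (suc _))) = P0

prodK : ℕ → Series
prodK zero    = S1
prodK (suc m) = prodK m *S factorK (suc m)

term1 : ℕ → Series
term1 m = monomial (2 *ℕ m) (+ ((m !) *ℕ ((m ∸ 1) !))) *S invS (prodK m)

term2 : ℕ → Series
term2 m = monomial (2 *ℕ m ∸ 1) (+ (((m ∸ 1) !) *ℕ ((m ∸ 1) !))) *S invS (prodK m)

-- Σ_{m≥1} (term1 m + term2 m): the m-th summand has t-order 2m-1 ≥ m,
-- so the coefficient of t^n only receives contributions from m = 1..n.
rhsSeries : Series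
rhsSeries n i = sumTo n (λ m → if m ≡ᵇ 0 then + 0 else (term1 m n i + term2 m n i))

lhsSeries : Series
lhsSeries zero    i = + 0
lhsSeries (suc n) i =
  + length (filterᵇ (λ w → inCoᵇ w ∧ (dropOO w ≡ᵇ i)) (cycleReps (suc n)))

{-# OPTIONS --safe #-}
module Submission where

-- Deleting the largest letter N of a cycle in 𝔠_N^o leaves a cycle in 𝔠_{N-1}^o, and conversely N
-- may be inserted exactly in front of an odd letter. Of the m odd letters of a cycle with d
-- odd-odd drops, d end such a drop; inserting N there destroys it, and if N is odd every insertion
-- creates one. With D_m = m + (1-x) d/dx, the enumerators A_n(x) = Σ x^{drop_oo} therefore satisfy
-- A_{2m} = D_m A_{2m-1} and A_{2m+1} = x D_m A_{2m}. Since D_s (1-x)^j = (s-j)(1-x)^j, the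
-- coefficient of t^{2q} in t^{2m} / ∏_{k≤m} (1 + k²(1-x)t²), a multiple of (1-x)^{q-m}, is an
-- eigenvector of D_s with eigenvalue s-q+m, and so the right-hand side obeys the same recurrences.

open import Defs
open import Data.Nat using (ℕ)
open import Algebra.Bundles using (CommutativeRing; SemiringWithoutOne)
import Algebra.Properties.CommutativeSemigroup as CommutativeSemigroupProperties
open import Data.Bool using (Bool; true; false; T; _∧_; if_then_else_)
open import Data.Bool.Properties using (T-∧; T-≡; ∧-zeroʳ; ∧-identityʳ)
open import Data.Empty using (⊥-elim)
open import Data.Integer using (ℤ; +_; _+_; _*_; -_; _-_)
import Data.Integer.Properties as ℤₚ
open import Data.Integer.Tactic.RingSolver using (solve-∀)
open import Data.List using (List; []; _∷_; _++_; map; concatMap; zip; zipWith; length; filterᵇ; applyUpTo)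
open import Data.List.Membership.Propositional using (_∈_; lose)
open import Data.List.Membership.Propositional.Properties
  using (∈-map⁺; ∈-map⁻; ∈-++⁺ʳ; ∈-∃++; ∈-concatMap⁺; ∈-concatMap⁻; ∈-upTo⁺; ∈-upTo⁻; ∈-filter⁺; ∈-filter⁻)
open import Data.List.Membership.Propositional.Properties.WithK using (unique∧set⇒bag)
open import Data.List.Properties using (length-map; ∷-injectiveˡ; ∷-injectiveʳ)
open import Data.List.Relation.Binary.BagAndSetEquality using (∼bag⇒↭)
open import Data.List.Relation.Binary.Disjoint.Propositional using (Disjoint)
open import Data.List.Relation.Binary.Permutation.Propositional.Properties using (↭-length)
open import Data.List.Relation.Unary.All as All using (All; []; _∷_)
import Data.List.Relation.Unary.All.Properties as Allₚ
open import Data.List.Relation.Unary.AllPairs using (AllPairs; []; _∷_)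
import Data.List.Relation.Unary.AllPairs.Properties as AllPairsₚ
open import Data.List.Relation.Unary.Any using (Any; here; there; satisfied)
open import Data.List.Relation.Unary.Unique.Propositional using (Unique)
open import Data.List.Relation.Unary.Unique.Propositional.Properties using (map⁺; concat⁺; filter⁺; upTo⁺)
open import Data.Nat using (zero; suc; pred; _∸_; _!; _≤_; _<_; _<ᵇ_; _≡ᵇ_; s≤s; z≤n; s≤s⁻¹)
  renaming (_+_ to _+ℕ_; _*_ to _*ℕ_)
import Data.Nat.Properties as ℕₚ
import Data.Nat.Tactic.RingSolver as ℕ-RingSolver
open import Data.Product using (_×_; _,_; proj₁; proj₂; ∃)
open import Data.Sum using (_⊎_; inj₁; inj₂)
open import Data.Unit using (tt)
open import Function using (_∘_; _⇔_; mk⇔; Equivalence)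
open import Relation.Nullary.Decidable using (T?)

-- Cauchy products

-- The operator is the insertion rule itself: a cycle with m odd letters and d odd-odd drops yields
-- (m - d) x^d + d x^(d-1) = D_m x^d. The factorials fit for the following reason. Write Q_k for the
-- quotient t^(2k) / ∏ of index k. Cycles on [2q-1] and on [2q] have q odd letters, and for s = q
-- the eigenvalue of D_s at the coefficient of t^(2q) in Q_k is k, whatever q is. So D_q merely
-- changes weights, from ((k-1)!)² to k! (k-1)! to (k!)². The factor x comes from the denominators.
-- Let S be the sum with weights (k!)² at t^(2q). Removing the last factor of each denominator, in
-- the sum with weights ((k-1)!)² at t^(2q+2), leaves S - (1-x) S = x S.

module Convolution {c ℓ} (S : SemiringWithoutOne c ℓ) where
  open SemiringWithoutOne S
    renaming (Carrier to A; _+_ to _⊕_; _*_ to _⊛_; zero to annihil)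
  open CommutativeSemigroupProperties +-commutativeSemigroup using (interchange)
  open import Relation.Binary.Reasoning.Setoid setoid

  -- Recursion peels off index 0 of the left factor, so that inductions pass to `f ∘ suc`. The sums
  -- of the statement peel off the last summand; `sumTo-suc` mediates.
  conv : (ℕ → A) → (ℕ → A) → ℕ → A
  conv f g zero    = f 0 ⊛ g 0
  conv f g (suc n) = (f 0 ⊛ g (suc n)) ⊕ conv (f ∘ suc) g n

  conv-cong : ∀ {f f′ g g′} → (∀ n → f n ≈ f′ n) → (∀ n → g n ≈ g′ n) →
              ∀ n → conv f g n ≈ conv f′ g′ n
  conv-cong p q zero    = *-cong (p 0) (q 0)
  conv-cong p q (suc n) = +-cong (*-cong (p 0) (q (suc n))) (conv-cong (p ∘ suc) q n)

  conv-distribʳ : ∀ h f g n → conv (λ k → f k ⊕ g k) h n ≈ conv f h n ⊕ conv g h n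
  conv-distribʳ h f g zero    = distribʳ (h 0) (f 0) (g 0)
  conv-distribʳ h f g (suc n) =
    trans (+-cong (distribʳ (h (suc n)) (f 0) (g 0)) (conv-distribʳ h (f ∘ suc) (g ∘ suc) n))
          (interchange _ _ _ _)

  conv-distribˡ : ∀ f g h n → conv f (λ k → g k ⊕ h k) n ≈ conv f g n ⊕ conv f h n
  conv-distribˡ f g h zero    = distribˡ (f 0) (g 0) (h 0)
  conv-distribˡ f g h (suc n) =
    trans (+-cong (distribˡ (f 0) (g (suc n)) (h (suc n))) (conv-distribˡ (f ∘ suc) g h n))
          (interchange _ _ _ _)

  conv-scale : ∀ a f g n → conv (λ k → a ⊛ f k) g n ≈ a ⊛ conv f g n
  conv-scale a f g zero    = *-assoc a (f 0) (g 0)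
  conv-scale a f g (suc n) =
    trans (+-cong (*-assoc a (f 0) (g (suc n))) (conv-scale a (f ∘ suc) g n))
          (sym (distribˡ a _ _))

  -- The tail of `conv f g` is a scalar multiple of the tail of `g` plus `conv (f ∘ suc) g`.
  -- Distributivity and scaling settle the first part, induction with `f` shifted the second.
  conv-assoc : ∀ f g h n → conv (conv f g) h n ≈ conv f (conv g h) n
  conv-assoc f g h zero    = *-assoc (f 0) (g 0) (h 0)
  conv-assoc f g h (suc n) = begin
    ((f 0 ⊛ g 0) ⊛ h (suc n)) ⊕ conv (λ k → (f 0 ⊛ g (suc k)) ⊕ conv (f ∘ suc) g k) h n
      ≈⟨ +-cong (*-assoc _ _ _) (conv-distribʳ h (λ k → f 0 ⊛ g (suc k)) (conv (f ∘ suc) g) n) ⟩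
    (f 0 ⊛ (g 0 ⊛ h (suc n))) ⊕ (conv (λ k → f 0 ⊛ g (suc k)) h n ⊕ conv (conv (f ∘ suc) g) h n)
      ≈⟨ +-cong refl (+-cong (conv-scale (f 0) (g ∘ suc) h n) (conv-assoc (f ∘ suc) g h n)) ⟩
    (f 0 ⊛ (g 0 ⊛ h (suc n))) ⊕ ((f 0 ⊛ conv (g ∘ suc) h n) ⊕ conv (f ∘ suc) (conv g h) n)
      ≈⟨ +-assoc _ _ _ ⟨
    ((f 0 ⊛ (g 0 ⊛ h (suc n))) ⊕ (f 0 ⊛ conv (g ∘ suc) h n)) ⊕ conv (f ∘ suc) (conv g h) n
      ≈⟨ +-cong (distribˡ (f 0) _ _) refl ⟨
    (f 0 ⊛ ((g 0 ⊛ h (suc n)) ⊕ conv (g ∘ suc) h n)) ⊕ conv (f ∘ suc) (conv g h) n ∎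

  conv-zeroˡ : ∀ g n → conv (λ _ → 0#) g n ≈ 0#
  conv-zeroˡ g zero    = zeroˡ (g 0)
  conv-zeroˡ g (suc n) = trans (+-cong (zeroˡ _) (conv-zeroˡ g n)) (+-identityˡ 0#)

  conv-zeroʳ : ∀ f n → conv f (λ _ → 0#) n ≈ 0#
  conv-zeroʳ f zero    = zeroʳ (f 0)
  conv-zeroʳ f (suc n) = trans (+-cong (zeroʳ _) (conv-zeroʳ (f ∘ suc) n)) (+-identityˡ 0#)

  conv-const : ∀ f g → (∀ k → f (suc k) ≈ 0#) → ∀ n → conv f g n ≈ f 0 ⊛ g n
  conv-const f g p zero    = refl
  conv-const f g p (suc n) =
    trans (+-cong refl (trans (conv-cong {g = g} p (λ _ → refl) n) (conv-zeroˡ g n))) (+-identityʳ _)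

  -- The bundle makes the construction iterable: over ℤ it gives polynomials in x, over these the
  -- series in t.
  convolutionSemiring : SemiringWithoutOne c ℓ
  convolutionSemiring = record
    { Carrier = ℕ → A
    ; _≈_ = λ f g → ∀ n → f n ≈ g n
    ; _+_ = λ f g n → f n ⊕ g n
    ; _*_ = conv
    ; 0# = λ _ → 0#
    ; isSemiringWithoutOne = record
      { +-isCommutativeMonoid = record
        { isMonoid = record
          { isSemigroup = record
            { isMagma = record
              { isEquivalence = record
                { refl = λ _ → refl
                ; sym = λ p n → sym (p n)
                ; trans = λ p q n → trans (p n) (q n)
                }
              ; ∙-cong = λ p q n → +-cong (p n) (q n)
              }
            ; assoc = λ f g h n → +-assoc (f n) (g n) (h n)
            }
          ; identity = (λ f n → +-identityˡ (f n)) , (λ f n → +-identityʳ (f n))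
          }
        ; comm = λ f g n → +-comm (f n) (g n)
        }
      ; *-cong = conv-cong
      ; *-assoc = conv-assoc
      ; distrib = conv-distribˡ , conv-distribʳ
      ; zero = conv-zeroˡ , conv-zeroʳ
      }
    }

open import Relation.Binary.PropositionalEquality using (_≡_; _≢_; refl; sym; trans; cong; cong₂; subst; module ≡-Reasoning)

ℤ-semiring : SemiringWithoutOne _ _
ℤ-semiring = record { isSemiringWithoutOne = CommutativeRing.isSemiringWithoutOne ℤₚ.+-*-commutativeRing }

module ℤ[x] = Convolution ℤ-semiring
module ℤ[x][t] = Convolution ℤ[x].convolutionSemiring

-- Products of polynomials and series as Cauchy products

sumTo-cong : ∀ n {f g} → (∀ j → f j ≡ g j) → sumTo n f ≡ sumTo n g
sumTo-cong zero    p = p 0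
sumTo-cong (suc n) p = cong₂ _+_ (sumTo-cong n p) (p (suc n))

sumTo-suc : ∀ n f → sumTo (suc n) f ≡ f 0 + sumTo n (f ∘ suc)
sumTo-suc zero    f = refl
sumTo-suc (suc n) f =
  trans (cong (_+ f (suc (suc n))) (sumTo-suc n f)) (ℤₚ.+-assoc (f 0) _ _)

sumTo-+ : ∀ n f g → sumTo n (λ j → f j + g j) ≡ sumTo n f + sumTo n g
sumTo-+ zero    f g = refl
sumTo-+ (suc n) f g = trans (cong (_+ (f (suc n) + g (suc n))) (sumTo-+ n f g)) (interchange (sumTo n f) (sumTo n g) (f (suc n)) (g (suc n)))
  where
  interchange : ∀ a b c d → (a + b) + (c + d) ≡ (a + c) + (b + d)
  interchange = solve-∀

sumTo-* : ∀ n c f → sumTo n (λ j → c * f j) ≡ c * sumTo n f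
sumTo-* zero    c f = refl
sumTo-* (suc n) c f = trans (cong (_+ c * f (suc n)) (sumTo-* n c f)) (sym (ℤₚ.*-distribˡ-+ c (sumTo n f) (f (suc n))))

sumTo-vanish : ∀ n k f → (∀ j → n < j → f j ≡ + 0) → sumTo (k +ℕ n) f ≡ sumTo n f
sumTo-vanish n zero    f p = refl
sumTo-vanish n (suc k) f p =
  trans (cong₂ _+_ (sumTo-vanish n k f p) (p _ (s≤s (ℕₚ.m≤n+m n k)))) (ℤₚ.+-identityʳ _)

*P-conv : ∀ p q i → (p *P q) i ≡ ℤ[x].conv p q i
*P-conv p q zero    = refl
*P-conv p q (suc i) = trans (sumTo-suc i _) (cong (λ z → p 0 * q (suc i) + z) (*P-conv (p ∘ suc) q i))

*S-conv : ∀ f g n i → (f *S g) n i ≡ ℤ[x][t].conv f g n i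
*S-conv f g zero    i = *P-conv (f 0) (g 0) i
*S-conv f g (suc n) i =
  trans (sumTo-suc n _) (cong₂ _+_ (*P-conv (f 0) (g (suc n)) i) (*S-conv (f ∘ suc) g n i))

xP : Poly → Poly
xP p zero    = + 0
xP p (suc i) = p i

yP : Poly → Poly
yP p i = p i - xP p i

Pconst-conv : ∀ c p i → ℤ[x].conv (Pconst c) p i ≡ c * p i
Pconst-conv c p = ℤ[x].conv-const (Pconst c) p (λ _ → refl)

oneMinusX-conv : ∀ p i → ℤ[x].conv oneMinusX p i ≡ yP p i
oneMinusX-conv p zero    = one-minus-zero (p 0)
  where
  one-minus-zero : ∀ a → + 1 * a ≡ a - + 0
  one-minus-zero = solve-∀
oneMinusX-conv p (suc i) =
  trans (cong (λ z → + 1 * p (suc i) + z) (ℤ[x].conv-const (oneMinusX ∘ suc) p (λ _ → refl) i))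
        (one-minus (p (suc i)) (p i))
  where
  one-minus : ∀ a b → + 1 * a + - (+ 1) * b ≡ a - b
  one-minus = solve-∀

shift : ℕ → Series → Series
shift zero    g n       = g n
shift (suc d) g zero    = P0
shift (suc d) g (suc n) = shift d g n

monomial-conv : ∀ d c g n i → ℤ[x][t].conv (monomial d c) g n i ≡ c * shift d g n i
monomial-conv zero c g n i =
  trans (ℤ[x][t].conv-const (monomial 0 c) g (λ _ _ → refl) n i) (Pconst-conv c (g n) i)
monomial-conv (suc d) c g zero i =
  trans (ℤ[x].conv-zeroˡ (g 0) i) (sym (ℤₚ.*-zeroʳ c))
monomial-conv (suc d) c g (suc n) i =
  trans (cong₂ _+_ (ℤ[x].conv-zeroˡ (g (suc n)) i) (monomial-conv d c g n i)) (ℤₚ.+-identityˡ _)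

-- Reciprocals of the denominators

square : ℕ → ℤ
square k = + (k *ℕ k)

yP-zero : ∀ i → yP P0 i ≡ + 0
yP-zero zero    = refl
yP-zero (suc i) = refl

*-yP-zero : ∀ k i → k * yP P0 i ≡ + 0
*-yP-zero k i = trans (cong (k *_) (yP-zero i)) (ℤₚ.*-zeroʳ k)

+-yP-zero : ∀ a k i → a ≡ a + k * yP P0 i
+-yP-zero a k i = sym (trans (cong (λ z → a + z) (*-yP-zero k i)) (ℤₚ.+-identityʳ a))

-‿yP-zero : ∀ a k i → a ≡ a - k * yP P0 i
-‿yP-zero a k i = sym (trans (cong (λ z → a - z) (*-yP-zero k i)) (ℤₚ.+-identityʳ a))

factorK-conv : ∀ k g n i → ℤ[x][t].conv (factorK k) g n i ≡ g n i + square k * yP (shift 2 g n) i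
factorK-conv k g zero i = trans (Pconst-conv (+ 1) (g 0) i)
  (trans (ℤₚ.*-identityˡ _) (+-yP-zero (g 0 i) (square k) i))
factorK-conv k g (suc zero) i =
  trans (cong₂ _+_ (Pconst-conv (+ 1) (g 1) i) (ℤ[x].conv-zeroˡ (g 0) i))
  (trans (ℤₚ.+-identityʳ _) (trans (ℤₚ.*-identityˡ _) (+-yP-zero (g 1 i) (square k) i)))
factorK-conv k g (suc (suc n)) i =
  trans (cong₂ _+_ (Pconst-conv (+ 1) (g (suc (suc n))) i)
          (cong₂ _+_ (ℤ[x].conv-zeroˡ (g (suc n)) i)
            (trans (ℤ[x][t].conv-const (λ j → factorK k (suc (suc j))) g (λ _ _ → refl) n i) top)))
        (tidy (g (suc (suc n)) i) _)
  where
  tidy : ∀ a b → + 1 * a + (+ 0 + b) ≡ a + b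
  tidy = solve-∀
  top : ℤ[x].conv (Pconst (square k) *P oneMinusX) (g n) i ≡ square k * yP (g n) i
  top = trans (ℤ[x].conv-cong {g = g n} (*P-conv (Pconst (square k)) oneMinusX) (λ _ → refl) i)
       (trans (ℤ[x].conv-assoc (Pconst (square k)) oneMinusX (g n) i)
       (trans (Pconst-conv (square k) _ i) (cong (square k *_) (oneMinusX-conv (g n) i))))

-- The equation (1 + k²(1-x)t²) G_k = G_(k-1), solved coefficient by coefficient. Unlike `invS`,
-- whose recursion involves all earlier coefficients, this one has two terms, which is what the
-- eigenvector argument can follow.
inverseProd : ℕ → Series
inverseProd zero    n             = S1 n
inverseProd (suc m) zero          = inverseProd m 0
inverseProd (suc m) (suc zero)    = inverseProd m 1
inverseProd (suc m) (suc (suc n)) i =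
  inverseProd m (suc (suc n)) i - square (suc m) * yP (inverseProd (suc m) n) i

inverseProd-step : ∀ m n i → inverseProd (suc m) n i
  ≡ inverseProd m n i - square (suc m) * yP (shift 2 (inverseProd (suc m)) n) i
inverseProd-step m zero          i = -‿yP-zero (inverseProd m 0 i) (square (suc m)) i
inverseProd-step m (suc zero)    i = -‿yP-zero (inverseProd m 1 i) (square (suc m)) i
inverseProd-step m (suc (suc n)) i = refl

-- Reassociation lets the new factor meet `inverseProd (suc m)`, which it turns into `inverseProd m`
-- by construction.
prodK-inverse : ∀ m n i → ℤ[x][t].conv (prodK m) (inverseProd m) n i ≡ S1 n i
prodK-inverse zero n i =
  trans (ℤ[x][t].conv-const S1 S1 (λ _ _ → refl) n i)
        (trans (Pconst-conv (+ 1) (S1 n) i) (ℤₚ.*-identityˡ _))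
prodK-inverse (suc m) n i = begin
  ℤ[x][t].conv (prodK m *S factorK (suc m)) G n i
    ≡⟨ ℤ[x][t].conv-cong {g = G} (*S-conv (prodK m) (factorK (suc m))) (λ _ _ → refl) n i ⟩
  ℤ[x][t].conv (ℤ[x][t].conv (prodK m) (factorK (suc m))) G n i
    ≡⟨ ℤ[x][t].conv-assoc (prodK m) (factorK (suc m)) G n i ⟩
  ℤ[x][t].conv (prodK m) (ℤ[x][t].conv (factorK (suc m)) G) n i
    ≡⟨ ℤ[x][t].conv-cong {f = prodK m} (λ _ _ → refl) factor n i ⟩
  ℤ[x][t].conv (prodK m) (inverseProd m) n i
    ≡⟨ prodK-inverse m n i ⟩
  S1 n i ∎
  where
  open ≡-Reasoning
  G = inverseProd (suc m)
  cancel : ∀ a b → (a - b) + b ≡ a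
  cancel = solve-∀
  factor : ∀ n i → ℤ[x][t].conv (factorK (suc m)) G n i ≡ inverseProd m n i
  factor n i = trans (factorK-conv (suc m) G n i)
    (trans (cong (_+ square (suc m) * yP (shift 2 G n) i) (inverseProd-step m n i)) (cancel _ _))

prodK-0 : ∀ m i → prodK m 0 i ≡ Pconst (+ 1) i
prodK-0 zero    i = refl
prodK-0 (suc m) i = begin
  (prodK m 0 *P Pconst (+ 1)) i            ≡⟨ *P-conv (prodK m 0) (Pconst (+ 1)) i ⟩
  ℤ[x].conv (prodK m 0) (Pconst (+ 1)) i   ≡⟨ ℤ[x].conv-cong {g = Pconst (+ 1)} (prodK-0 m) (λ _ → refl) i ⟩
  ℤ[x].conv (Pconst (+ 1)) (Pconst (+ 1)) i ≡⟨ Pconst-conv (+ 1) (Pconst (+ 1)) i ⟩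
  + 1 * Pconst (+ 1) i                     ≡⟨ ℤₚ.*-identityˡ _ ⟩
  Pconst (+ 1) i ∎
  where open ≡-Reasoning

module _ (a b : Series) (a₀ : ∀ i → a 0 i ≡ Pconst (+ 1) i) (ab : ∀ n i → (a *S b) n i ≡ S1 n i) where
  private
    a₀-mul : ∀ p i → (a 0 *P p) i ≡ p i
    a₀-mul p i = trans (*P-conv (a 0) p i)
      (trans (ℤ[x].conv-cong {g = p} a₀ (λ _ → refl) i) (trans (Pconst-conv (+ 1) p i) (ℤₚ.*-identityˡ _)))

  -- `invRev` carries all coefficients computed so far, the latest first; the relation compares them
  -- with those of `b` pointwise.
  data Agrees : ℕ → List Poly → Set where
    base : ∀ {p} → (∀ i → p i ≡ b 0 i) → Agrees 0 (p ∷ [])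
    step : ∀ {n p ps} → (∀ i → p i ≡ b (suc n) i) → Agrees n ps → Agrees (suc n) (p ∷ ps)

  *P-congʳ : ∀ p {q r} → (∀ i → q i ≡ r i) → ∀ i → (p *P q) i ≡ (p *P r) i
  *P-congʳ p e i = sumTo-cong i (λ j → cong (p j *_) (e (i ∸ j)))

  -- `upTo` is `applyUpTo` of the identity, whose tail is `applyUpTo` of `suc`; an arbitrary index
  -- map `f` makes the induction close.
  sumP-zipWith : ∀ {n ps} (h : ℕ → Poly) (f : ℕ → ℕ) → Agrees n ps → ∀ i →
    sumP (zipWith (λ j q → h j *P q) (applyUpTo f (suc n)) ps) i ≡ sumTo n (λ j → (h (f j) *P b (n ∸ j)) i)
  sumP-zipWith h f (base e) i = trans (ℤₚ.+-identityʳ _) (*P-congʳ (h (f 0)) e i)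
  sumP-zipWith {suc n} h f (step e es) i =
    trans (cong₂ _+_ (*P-congʳ (h (f 0)) e i) (sumP-zipWith h (f ∘ suc) es i)) (sym (sumTo-suc n _))

  -- Since a has constant term 1, the coefficient of t^(n+1) in a b = 1 says that b_(n+1) and the
  -- sum over the earlier b_j add up to 0, which is the defining equation of `invRev`.
  invRev-agrees : ∀ n → Agrees n (invRev a n)
  invRev-agrees zero    = base (λ i → trans (sym (ab 0 i)) (a₀-mul (b 0) i))
  invRev-agrees (suc n) = step coefficient (invRev-agrees n)
    where
    opposite : ∀ x y → x + y ≡ + 0 → - y ≡ x
    opposite x y e = trans (sym (ℤₚ.+-identityˡ (- y))) (trans (cong (_- y) (sym e)) (cancel x y))
      where
      cancel : ∀ x y → (x + y) - y ≡ x
      cancel = solve-∀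
    coefficient : ∀ i → (-P sumP (zipWith (λ j q → a (suc j) *P q) (applyUpTo (λ j → j) (suc n)) (invRev a n))) i ≡ b (suc n) i
    coefficient i = opposite _ _ (begin
      b (suc n) i + sumP (zipWith (λ j q → a (suc j) *P q) (applyUpTo (λ j → j) (suc n)) (invRev a n)) i
        ≡⟨ cong₂ _+_ (sym (a₀-mul (b (suc n)) i)) (sumP-zipWith (a ∘ suc) (λ j → j) (invRev-agrees n) i) ⟩
      (a 0 *P b (suc n)) i + sumTo n (λ j → (a (suc j) *P b (n ∸ j)) i)
        ≡⟨ sumTo-suc n (λ j → (a j *P b (suc n ∸ j)) i) ⟨
      (a *S b) (suc n) i
        ≡⟨ ab (suc n) i ⟩
      + 0 ∎)
      where open ≡-Reasoning

  invS-unique : ∀ n i → invS a n i ≡ b n i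
  invS-unique n i = head-agrees (invRev-agrees n)
    where
    head-agrees : ∀ {n ps} → Agrees n ps → headP ps i ≡ b n i
    head-agrees (base e)   = e i
    head-agrees (step e _) = e i

invS-prodK : ∀ m n i → invS (prodK m) n i ≡ inverseProd m n i
invS-prodK m = invS-unique (prodK m) (inverseProd m) (prodK-0 m)
  (λ n i → trans (*S-conv (prodK m) (inverseProd m) n i) (prodK-inverse m n i))

monomial-invS : ∀ d c m n i → (monomial d c *S invS (prodK m)) n i ≡ c * shift d (inverseProd m) n i
monomial-invS d c m n i =
  trans (*S-conv (monomial d c) (invS (prodK m)) n i)
  (trans (ℤ[x][t].conv-cong {f = monomial d c} (λ _ _ → refl) (invS-prodK m) n i)
         (monomial-conv d c (inverseProd m) n i))

-- The differential operator D and the right-hand side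

xP-cong : ∀ {p q} → (∀ i → p i ≡ q i) → ∀ i → xP p i ≡ xP q i
xP-cong e zero    = refl
xP-cong e (suc i) = e i

yP-cong : ∀ {p q} → (∀ i → p i ≡ q i) → ∀ i → yP p i ≡ yP q i
yP-cong e zero    = cong (_- + 0) (e 0)
yP-cong e (suc i) = cong₂ _-_ (e (suc i)) (e i)

yP-* : ∀ c p i → yP (λ j → c * p j) i ≡ c * yP p i
yP-* c p zero    = *-distrib-zero c (p 0)
  where
  *-distrib-zero : ∀ c a → c * a - + 0 ≡ c * (a - + 0)
  *-distrib-zero = solve-∀
yP-* c p (suc i) = *-distrib-- c (p (suc i)) (p i)
  where
  *-distrib-- : ∀ c a b → c * a - c * b ≡ c * (a - b)
  *-distrib-- = solve-∀

yP-vanish : ∀ p → (∀ i → p i ≡ + 0) → ∀ i → yP p i ≡ + 0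
yP-vanish p e i = trans (yP-cong e i) (yP-zero i)

-- The operator  s + (1 - x) d/dx  on coefficient sequences.
D : ℤ → Poly → Poly
D s p i = (s - + i) * p i + + suc i * p (suc i)

D-cong : ∀ s {p q} → (∀ i → p i ≡ q i) → ∀ i → D s p i ≡ D s q i
D-cong s e i = cong₂ (λ a b → (s - + i) * a + + suc i * b) (e i) (e (suc i))

D-vanish : ∀ s {p} → (∀ i → p i ≡ + 0) → ∀ i → D s p i ≡ + 0
D-vanish s e i = trans (D-cong s e i) (zeros (s - + i) (+ suc i))
  where
  zeros : ∀ a b → a * + 0 + b * + 0 ≡ + 0
  zeros = solve-∀

D-linear : ∀ s k p q i → D s (λ j → p j - k * q j) i ≡ D s p i - k * D s q i
D-linear s k p q i = linear (s - + i) (+ suc i) k (p i) (p (suc i)) (q i) (q (suc i))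
  where
  linear : ∀ a b k p p′ q q′ → a * (p - k * q) + b * (p′ - k * q′) ≡ (a * p + b * p′) - k * (a * q + b * q′)
  linear = solve-∀

-- Product rule: 1 - x has derivative -1, so applying (1-x) d/dx to (1-x) p gives (1-x) times (1-x)
-- p′ - p.
D-yP : ∀ s p i → D s (yP p) i ≡ yP (D (s - + 1) p) i
D-yP s p zero = constant s (p 0) (p 1)
  where
  constant : ∀ s a b → (s - + 0) * (a - + 0) + + 1 * (b - a) ≡ ((s - + 1 - + 0) * a + + 1 * b) - + 0
  constant = solve-∀
D-yP s p (suc i) = general s (+ i) (p i) (p (suc i)) (p (suc (suc i)))
  where
  general : ∀ s i a b c → (s - (+ 1 + i)) * (b - a) + (+ 1 + (+ 1 + i)) * (c - b)
    ≡ ((s - + 1 - (+ 1 + i)) * b + (+ 1 + (+ 1 + i)) * c) - ((s - + 1 - i) * a + (+ 1 + i) * b)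
  general = solve-∀

D-sumTo : ∀ s (c : ℕ → ℤ) (v : ℕ → Poly) n i →
  D s (λ j → sumTo n (λ m → c m * v m j)) i ≡ sumTo n (λ m → c m * D s (v m) i)
D-sumTo s c v zero    i = scale (s - + i) (+ suc i) (c 0) (v 0 i) (v 0 (suc i))
  where
  scale : ∀ a b c x y → a * (c * x) + b * (c * y) ≡ c * (a * x + b * y)
  scale = solve-∀
D-sumTo s c v (suc n) i =
  trans (split (s - + i) (+ suc i) (c (suc n)) (v (suc n) i) (v (suc n) (suc i)) _ _)
        (cong (_+ c (suc n) * D s (v (suc n)) i) (D-sumTo s c v n i))
  where
  split : ∀ a b c x y u w → a * (u + c * x) + b * (w + c * y) ≡ (a * u + b * w) + c * (a * x + b * y)
  split = solve-∀

-- Each step adds two constructors, so `shift` and `oddᵇ` reduce on it in the steps of two that the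
-- recursions take.
double : ℕ → ℕ
double zero    = zero
double (suc q) = suc (suc (double q))

double-+ : ∀ q → double q ≡ q +ℕ q
double-+ zero    = refl
double-+ (suc q) = cong suc (trans (cong suc (double-+ q)) (sym (ℕₚ.+-suc q q)))

-- t^{2m} / ∏_{k=1}^m (1 + k²(1-x)t²)
summand : ℕ → Series
summand m = shift (2 *ℕ m) (inverseProd m)

shift-inverseProd : ∀ m d n i → shift d (inverseProd (suc m)) n i
  ≡ shift d (inverseProd m) n i - square (suc m) * yP (shift (suc (suc d)) (inverseProd (suc m)) n) i
shift-inverseProd m zero    n       i = inverseProd-step m n i
shift-inverseProd m (suc d) zero    i = -‿yP-zero (+ 0) (square (suc m)) i
shift-inverseProd m (suc d) (suc n) i = shift-inverseProd m d n i

summand-shift : ∀ m n → summand (suc m) n ≡ shift (suc (suc (2 *ℕ m))) (inverseProd (suc m)) n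
summand-shift m n = cong (λ d → shift d (inverseProd (suc m)) n) (ℕₚ.*-suc 2 m)

-- Multiplying the quotient of index m + 1 by the last factor of its denominator leaves t² times the
-- quotient of index m.
summand-suc : ∀ m n i → summand (suc m) (suc (suc n)) i ≡ summand m n i - square (suc m) * yP (summand (suc m) n) i
summand-suc m n i = begin
  summand (suc m) (suc (suc n)) i                      ≡⟨ cong (λ p → p i) (summand-shift m (suc (suc n))) ⟩
  shift (2 *ℕ m) (inverseProd (suc m)) n i       ≡⟨ shift-inverseProd m (2 *ℕ m) n i ⟩
  summand m n i - square (suc m) * yP (shift (suc (suc (2 *ℕ m))) (inverseProd (suc m)) n) i
    ≡⟨ cong (λ p → summand m n i - square (suc m) * yP p i) (summand-shift m n) ⟨
  summand m n i - square (suc m) * yP (summand (suc m) n) i ∎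
  where open ≡-Reasoning

summand-suc-vanish : ∀ m n → (∀ i → summand m n i ≡ + 0) → (∀ i → summand (suc m) n i ≡ + 0) → ∀ i → summand (suc m) (suc (suc n)) i ≡ + 0
summand-suc-vanish m n e e′ i = trans (summand-suc m n i)
  (trans (cong₂ (λ a b → a - square (suc m) * b) (e i) (yP-vanish (summand (suc m) n) e′ i)) (zeros (square (suc m))))
  where
  zeros : ∀ a → + 0 - a * + 0 ≡ + 0
  zeros = solve-∀

summand-odd : ∀ m q i → summand m (suc (double q)) i ≡ + 0
summand-odd zero    q       i = refl
summand-odd (suc m) zero    i = cong (λ p → p i) (summand-shift m 1)
summand-odd (suc m) (suc q) i = summand-suc-vanish m _ (summand-odd m q) (summand-odd (suc m) q) i

summand-high : ∀ m q → q < m → ∀ i → summand m (double q) i ≡ + 0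
summand-high (suc m) zero    q<m i = refl
summand-high (suc m) (suc q) q<m i =
  summand-suc-vanish m _ (summand-high m q (s≤s⁻¹ q<m)) (summand-high (suc m) q (ℕₚ.<-trans (ℕₚ.n<1+n q) q<m)) i

-- Both terms of `summand-suc` have the same eigenvalue: moving 1 - x past `D` lowers s by 1, and
-- the index m + 1 in place of m makes up for it. The induction therefore needs every s at once.
summand-eigen : ∀ s m q i → D s (summand m (double q)) i ≡ (s - + q + + m) * summand m (double q) i
summand-eigen s zero zero zero = constant s
  where
  constant : ∀ s → (s - + 0) * + 1 + + 1 * + 0 ≡ (s - + 0 + + 0) * + 1
  constant = solve-∀
summand-eigen s zero zero (suc i) = zeros (s - + suc i) (+ suc (suc i)) (s - + 0 + + 0)
  where
  zeros : ∀ a b c → a * + 0 + b * + 0 ≡ c * + 0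
  zeros = solve-∀
summand-eigen s zero    (suc q) i = trans (D-vanish s (λ _ → refl) i) (sym (ℤₚ.*-zeroʳ (s - + suc q + + 0)))
summand-eigen s (suc m) zero    i = trans (D-vanish s (λ _ → refl) i) (sym (ℤₚ.*-zeroʳ (s - + 0 + + suc m)))
summand-eigen s (suc m) (suc q) i = begin
  D s (summand (suc m) (double (suc q))) i
    ≡⟨ D-cong s (summand-suc m (double q)) i ⟩
  D s (λ j → summand m (double q) j - k * yP (summand (suc m) (double q)) j) i
    ≡⟨ D-linear s k (summand m (double q)) (yP (summand (suc m) (double q))) i ⟩
  D s (summand m (double q)) i - k * D s (yP (summand (suc m) (double q))) i
    ≡⟨ cong₂ (λ a b → a - k * b) (summand-eigen s m q i) (trans (D-yP s (summand (suc m) (double q)) i)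
         (trans (yP-cong (summand-eigen (s - + 1) (suc m) q) i) (yP-* (s - + 1 - + q + + suc m) (summand (suc m) (double q)) i))) ⟩
  (s - + q + + m) * summand m (double q) i - k * ((s - + 1 - + q + + suc m) * yP (summand (suc m) (double q)) i)
    ≡⟨ collect s (+ q) (+ m) k (summand m (double q) i) (yP (summand (suc m) (double q)) i) ⟩
  (s - + suc q + + suc m) * (summand m (double q) i - k * yP (summand (suc m) (double q)) i)
    ≡⟨ cong ((s - + suc q + + suc m) *_) (summand-suc m (double q) i) ⟨
  (s - + suc q + + suc m) * summand (suc m) (double (suc q)) i ∎
  where
  open ≡-Reasoning
  k = square (suc m)
  collect : ∀ s q m k a b → (s - q + m) * a - k * ((s - + 1 - q + (+ 1 + m)) * b)
    ≡ (s - (+ 1 + q) + (+ 1 + m)) * (a - k * b)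
  collect = solve-∀

-- These will be the coefficients of t^(2p+2) and t^(2p+1); index m stands for m + 1 in the theorem.
-- Multiplying the second sum by t turns its t^(2m+1) into t^(2m+2), so both parities read `summand`
-- at the same place.
evenCoefficient oddCoefficient : ℕ → Poly
evenCoefficient p i = sumTo p (λ m → + ((suc m !) *ℕ (m !)) * summand (suc m) (double (suc p)) i)
oddCoefficient  p i = sumTo p (λ m → + ((m !) *ℕ (m !)) * summand (suc m) (double (suc p)) i)

-- At s = q the eigenvalue no longer depends on q and supplies exactly the factor by which a
-- factorial grows.
summand-eigen′ : ∀ p m i → D (+ suc p) (summand (suc m) (double (suc p))) i ≡ + suc m * summand (suc m) (double (suc p)) i
summand-eigen′ p m i = trans (summand-eigen (+ suc p) (suc m) (suc p) i)
  (cong (_* summand (suc m) (double (suc p)) i) (cancel (+ suc p) (+ suc m)))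
  where
  cancel : ∀ a b → a - a + b ≡ b
  cancel = solve-∀

absorb : ∀ a b v → + a * (+ b * v) ≡ + (b *ℕ a) * v
absorb a b v = trans (sym (ℤₚ.*-assoc (+ a) (+ b) v))
  (cong (_* v) (trans (ℤₚ.*-comm (+ a) (+ b)) (sym (ℤₚ.pos-* b a))))

evenCoefficient-step : ∀ p i → evenCoefficient p i ≡ D (+ suc p) (oddCoefficient p) i
evenCoefficient-step p i = sym (trans
  (D-sumTo (+ suc p) (λ m → + ((m !) *ℕ (m !))) (λ m → summand (suc m) (double (suc p))) p i)
  (sumTo-cong p λ m → trans (cong (+ ((m !) *ℕ (m !)) *_) (summand-eigen′ p m i))
    (trans (absorb ((m !) *ℕ (m !)) (suc m) _)
      (cong (λ c → + c * summand (suc m) (double (suc p)) i) (sym (ℕₚ.*-assoc (suc m) (m !) (m !)))))))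

private
  -- The weights are those of `oddCoefficient` moved up by one index, while the power of t stays;
  -- `oddCoefficient-step` realigns the two.
  squaresCoefficient : ℕ → Poly
  squaresCoefficient p i = sumTo p (λ m → + ((suc m !) *ℕ (suc m !)) * summand (suc m) (double (suc p)) i)

D-evenCoefficient : ∀ p i → D (+ suc p) (evenCoefficient p) i ≡ squaresCoefficient p i
D-evenCoefficient p i = trans
  (D-sumTo (+ suc p) (λ m → + ((suc m !) *ℕ (m !))) (λ m → summand (suc m) (double (suc p))) p i)
  (sumTo-cong p λ m → trans (cong (+ ((suc m !) *ℕ (m !)) *_) (summand-eigen′ p m i))
    (trans (absorb ((suc m !) *ℕ (m !)) (suc m) _)
      (cong (λ c → + c * summand (suc m) (double (suc p)) i) (rearrange (suc m) (suc m !) (m !)))))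
  where
  rearrange : ∀ a b c → a *ℕ (b *ℕ c) ≡ b *ℕ (a *ℕ c)
  rearrange = ℕ-RingSolver.solve-∀

yP-sumTo : ∀ n (c : ℕ → ℤ) (v : ℕ → Poly) i →
  yP (λ j → sumTo n (λ m → c m * v m j)) i ≡ sumTo n (λ m → c m * yP (v m) i)
yP-sumTo zero    c v i = yP-* (c 0) (v 0) i
yP-sumTo (suc n) c v i = trans (split i)
  (cong₂ _+_ (yP-sumTo n c v i) (yP-* (c (suc n)) (v (suc n)) i))
  where
  f g : Poly
  f j = sumTo n (λ m → c m * v m j)
  g j = c (suc n) * v (suc n) j
  split₀ : ∀ a b → a + b - + 0 ≡ (a - + 0) + (b - + 0)
  split₀ = solve-∀
  split₁ : ∀ a b a′ b′ → a + b - (a′ + b′) ≡ (a - a′) + (b - b′)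
  split₁ = solve-∀
  split : ∀ i → yP (λ j → f j + g j) i ≡ yP f i + yP g i
  split zero    = split₀ (f 0) (g 0)
  split (suc i) = split₁ (f (suc i)) (g (suc i)) (f i) (g i)

-- With S for `squaresCoefficient p`, `summand-suc` splits the left side into two sums. The factor
-- (m+1)² raises (m!)² to ((m+1)!)², so they are S and -(1-x) S, with sum x S.
oddCoefficient-step : ∀ p i → oddCoefficient (suc p) i ≡ xP (D (+ suc p) (evenCoefficient p)) i
oddCoefficient-step p i = begin
  oddCoefficient (suc p) i
    ≡⟨ sumTo-cong (suc p) (λ m → trans (cong (+ ((m !) *ℕ (m !)) *_) (summand-suc m (double (suc p)) i)) (expand m)) ⟩
  sumTo (suc p) (λ m → + ((m !) *ℕ (m !)) * v m i + - (+ 1) * (+ ((suc m !) *ℕ (suc m !)) * yP (v (suc m)) i))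
    ≡⟨ sumTo-+ (suc p) _ _ ⟩
  sumTo (suc p) (λ m → + ((m !) *ℕ (m !)) * v m i)
    + sumTo (suc p) (λ m → - (+ 1) * (+ ((suc m !) *ℕ (suc m !)) * yP (v (suc m)) i))
    -- Index 0 leaves the first sum because `summand 0` is the constant 1; the last index leaves the
    -- second because its order in t, 2p + 4, exceeds 2p + 2.
    ≡⟨ cong₂ _+_ (trans (sumTo-suc p _) (ℤₚ.+-identityˡ (squaresCoefficient p i)))
         (trans (sumTo-* (suc p) (- (+ 1)) _) (cong (- (+ 1) *_) (trans top (sym (yP-sumTo p (λ m → + ((suc m !) *ℕ (suc m !))) (v ∘ suc) i))))) ⟩
  squaresCoefficient p i + - (+ 1) * yP (squaresCoefficient p) i
    ≡⟨ cancel (squaresCoefficient p i) (xP (squaresCoefficient p) i) ⟩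
  xP (squaresCoefficient p) i
    ≡⟨ xP-cong (λ j → sym (D-evenCoefficient p j)) i ⟩
  xP (D (+ suc p) (evenCoefficient p)) i ∎
  where
  open ≡-Reasoning
  v : ℕ → Poly
  v m = summand m (double (suc p))
  distribute : ∀ a b x y → a * (x - b * y) ≡ a * x + - (+ 1) * ((a * b) * y)
  distribute = solve-∀
  squares : ∀ a b → (a *ℕ a) *ℕ (b *ℕ b) ≡ (b *ℕ a) *ℕ (b *ℕ a)
  squares = ℕ-RingSolver.solve-∀
  expand : ∀ m → + ((m !) *ℕ (m !)) * (v m i - square (suc m) * yP (v (suc m)) i)
    ≡ + ((m !) *ℕ (m !)) * v m i + - (+ 1) * (+ ((suc m !) *ℕ (suc m !)) * yP (v (suc m)) i)
  expand m = trans (distribute (+ ((m !) *ℕ (m !))) (square (suc m)) (v m i) (yP (v (suc m)) i))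
    (cong (λ c → + ((m !) *ℕ (m !)) * v m i + - (+ 1) * (c * yP (v (suc m)) i))
      (trans (sym (ℤₚ.pos-* ((m !) *ℕ (m !)) (suc m *ℕ suc m))) (cong +_ (squares (m !) (suc m)))))
  top : sumTo (suc p) (λ m → + ((suc m !) *ℕ (suc m !)) * yP (v (suc m)) i)
    ≡ sumTo p (λ m → + ((suc m !) *ℕ (suc m !)) * yP (v (suc m)) i)
  top = trans (cong (λ z → sumTo p (λ m → + ((suc m !) *ℕ (suc m !)) * yP (v (suc m)) i) + z)
      (trans (cong (+ ((suc (suc p) !) *ℕ (suc (suc p) !)) *_) (yP-vanish (v (suc (suc p))) (summand-high (suc (suc p)) (suc p) ℕₚ.≤-refl) i))
             (ℤₚ.*-zeroʳ (+ ((suc (suc p) !) *ℕ (suc (suc p) !))))))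
    (ℤₚ.+-identityʳ _)
  cancel : ∀ a b → a + - (+ 1) * (a - b) ≡ b
  cancel = solve-∀

rhsSeries-suc : ∀ n i → rhsSeries (suc n) i ≡ sumTo n (λ m →
  + ((suc m !) *ℕ (m !)) * summand (suc m) (suc n) i + + ((m !) *ℕ (m !)) * summand (suc m) (suc (suc n)) i)
rhsSeries-suc n i = trans (sumTo-suc n _) (trans (ℤₚ.+-identityˡ _) (sumTo-cong n λ m →
  cong₂ _+_ (monomial-invS (2 *ℕ suc m) _ (suc m) (suc n) i)
            -- By definition of `shift`, exponent 2m + 1 read at `suc n` equals exponent 2m + 2 read
            -- at `suc (suc n)`.
            (monomial-invS (2 *ℕ suc m ∸ 1) _ (suc m) (suc n) i)))

rhsSeries-even : ∀ p i → rhsSeries (double (suc p)) i ≡ evenCoefficient p i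
rhsSeries-even p i = begin
  rhsSeries (double (suc p)) i
    ≡⟨ rhsSeries-suc (suc (double p)) i ⟩
  sumTo (suc (double p)) (λ m → + ((suc m !) *ℕ (m !)) * summand (suc m) (double (suc p)) i
    + + ((m !) *ℕ (m !)) * summand (suc m) (suc (double (suc p))) i)
    ≡⟨ sumTo-cong (suc (double p)) (λ m →
         trans (cong (λ z → f m + + ((m !) *ℕ (m !)) * z) (summand-odd (suc m) (suc p) i))
           (trans (cong (λ z → f m + z) (ℤₚ.*-zeroʳ (+ ((m !) *ℕ (m !))))) (ℤₚ.+-identityʳ _))) ⟩
  sumTo (suc (double p)) f
    -- The bound 2p + 1 is split as (p + 1) + p because the terms beyond p have order above 2p + 2.
    ≡⟨ cong (λ n → sumTo (suc n) f) (double-+ p) ⟩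
  sumTo (suc p +ℕ p) f
    ≡⟨ sumTo-vanish p (suc p) f (λ m p<m →
         trans (cong (+ ((suc m !) *ℕ (m !)) *_) (summand-high (suc m) (suc p) (s≤s p<m) i)) (ℤₚ.*-zeroʳ (+ ((suc m !) *ℕ (m !))))) ⟩
  evenCoefficient p i ∎
  where
  open ≡-Reasoning
  f : ℕ → ℤ
  f m = + ((suc m !) *ℕ (m !)) * summand (suc m) (double (suc p)) i

rhsSeries-odd : ∀ p i → rhsSeries (suc (double p)) i ≡ oddCoefficient p i
rhsSeries-odd p i = begin
  rhsSeries (suc (double p)) i
    ≡⟨ rhsSeries-suc (double p) i ⟩
  sumTo (double p) (λ m → + ((suc m !) *ℕ (m !)) * summand (suc m) (suc (double p)) i
    + + ((m !) *ℕ (m !)) * summand (suc m) (double (suc p)) i)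
    ≡⟨ sumTo-cong (double p) (λ m →
         trans (cong (λ z → + ((suc m !) *ℕ (m !)) * z + f m) (summand-odd (suc m) p i))
           (trans (cong (_+ f m) (ℤₚ.*-zeroʳ (+ ((suc m !) *ℕ (m !))))) (ℤₚ.+-identityˡ _))) ⟩
  sumTo (double p) f
    ≡⟨ cong (λ n → sumTo n f) (double-+ p) ⟩
  sumTo (p +ℕ p) f
    ≡⟨ sumTo-vanish p p f (λ m p<m →
         trans (cong (+ ((m !) *ℕ (m !)) *_) (summand-high (suc m) (suc p) (s≤s p<m) i)) (ℤₚ.*-zeroʳ (+ ((m !) *ℕ (m !))))) ⟩
  oddCoefficient p i ∎
  where
  open ≡-Reasoning
  f : ℕ → ℤ
  f m = + ((m !) *ℕ (m !)) * summand (suc m) (double (suc p)) i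

open Equivalence using (to; from)

-- Enumeration of cycles by insertion of the largest letter

∧⁻ : ∀ {x y} → T (x ∧ y) → T x × T y
∧⁻ = to T-∧

∧⁺ : ∀ {x y} → T x → T y → T (x ∧ y)
∧⁺ p q = from T-∧ (p , q)

allᵇ⁻ : ∀ {A : Set} (p : A → Bool) {xs x} → T (allᵇ p xs) → x ∈ xs → T (p x)
allᵇ⁻ p t (here refl) = proj₁ (∧⁻ t)
allᵇ⁻ p {y ∷ _} t (there x∈) = allᵇ⁻ p (proj₂ (∧⁻ {p y} t)) x∈

allᵇ⁺ : ∀ {A : Set} (p : A → Bool) {xs} → (∀ {x} → x ∈ xs → T (p x)) → T (allᵇ p xs)
allᵇ⁺ p {[]}     h = tt
allᵇ⁺ p {x ∷ xs} h = ∧⁺ (h (here refl)) (allᵇ⁺ p (h ∘ there))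

elemᵇ⁻ : ∀ v w → T (elemᵇ v w) → v ∈ w
elemᵇ⁻ v (u ∷ w) t with u ≡ᵇ v in eq
... | true  = here (sym (ℕₚ.≡ᵇ⇒≡ u v (from T-≡ eq)))
... | false = there (elemᵇ⁻ v w t)

elemᵇ⁺ : ∀ {v w} → v ∈ w → T (elemᵇ v w)
elemᵇ⁺ {v} {u ∷ w} v∈ with u ≡ᵇ v in eq
elemᵇ⁺ {v} {u ∷ w} v∈ | true = tt
elemᵇ⁺ {v} {u ∷ w} (here refl) | false = ⊥-elim (subst T eq (ℕₚ.≡⇒≡ᵇ v v refl))
elemᵇ⁺ {v} {u ∷ w} (there v∈) | false = elemᵇ⁺ v∈

∈-range⁺ : ∀ {n v} → 1 ≤ v → v ≤ n → v ∈ range n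
∈-range⁺ {v = suc v} _ v<n = ∈-map⁺ suc (∈-upTo⁺ v<n)

∈-range⁻ : ∀ {n v} → v ∈ range n → 1 ≤ v × v ≤ n
∈-range⁻ v∈ with _ , u∈ , refl ← ∈-map⁻ suc v∈ = s≤s z≤n , ∈-upTo⁻ u∈

∈-words⁺ : ∀ {n} k {w} → length w ≡ k → All (_∈ range n) w → w ∈ words n k
∈-words⁺ zero    {[]}    refl []       = here refl
∈-words⁺ {n} (suc k) {v ∷ w} eq (v∈ ∷ w∈) =
  ∈-concatMap⁺ (λ u → map (u ∷_) (words n k)) (lose v∈ (∈-map⁺ (v ∷_) (∈-words⁺ k (ℕₚ.suc-injective eq) w∈)))

∈-words-length : ∀ {n} k {w} → w ∈ words n k → length w ≡ k
∈-words-length zero    (here refl) = refl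
∈-words-length {n} (suc k) w∈
  with v , w∈v ← satisfied (∈-concatMap⁻ (λ u → map (u ∷_) (words n k)) {xs = range n} w∈)
  with _ , u∈ , refl ← ∈-map⁻ (v ∷_) w∈v = cong suc (∈-words-length k u∈)

-- The map `r` recovers the x from which an element of `f x` came, so the blocks of distinct x are
-- disjoint.
concatMap-unique : ∀ {A B : Set} {f : A → List B} (r : B → A) {xs} → Unique xs →
  (∀ {x} → x ∈ xs → Unique (f x)) → (∀ {x y} → x ∈ xs → y ∈ f x → r y ≡ x) → Unique (concatMap f xs)
concatMap-unique {f = f} r {xs} xs! f! inv = concat⁺ (Allₚ.map⁺ (All.tabulate f!)) (AllPairsₚ.map⁺ (disjoint xs! inv))
  where
  disjoint : ∀ {ys} → Unique ys → (∀ {x y} → x ∈ ys → y ∈ f x → r y ≡ x) →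
             AllPairs (λ x y → Disjoint (f x) (f y)) ys
  disjoint []          inv = []
  disjoint (y∉ ∷ ys!) inv =
    All.tabulate (λ z∈ (p , q) → All.lookup y∉ z∈ (trans (sym (inv (here refl) p)) (inv (there z∈) q)))
    ∷ disjoint ys! (inv ∘ there)

words-unique : ∀ n k → Unique (words n k)
words-unique n zero    = [] ∷ []
words-unique n (suc k) = concatMap-unique head₀ (map⁺ ℕₚ.suc-injective (upTo⁺ n))
  (λ _ → map⁺ ∷-injectiveʳ (words-unique n k)) (λ _ → head₀-map)
  where
  head₀ : List ℕ → ℕ
  head₀ []      = 0
  head₀ (v ∷ _) = v
  head₀-map : ∀ {v w} → w ∈ map (v ∷_) (words n k) → head₀ w ≡ v
  head₀-map {v} w∈ with _ , _ , refl ← ∈-map⁻ (v ∷_) w∈ = refl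

-- A cycle [1 t] is handled through the word t. Suffixes of t are read as paths a, t, 1;
-- the closing pair ends in the odd letter 1, so it never obstructs Good.
data Good : ℕ → List ℕ → Set where
  []  : ∀ {a} → Good a []
  _∷_ : ∀ {a b t} → (b < a → T (oddᵇ b)) → Good b t → Good a (b ∷ t)

inCoᵇ⇔Good : ∀ t → T (inCoᵇ (1 ∷ t)) ⇔ Good 1 t
inCoᵇ⇔Good t = mk⇔ (forward 1 t) (backward 1 t)
  where
  forward : ∀ a t → T (allᵇ (oddᵇ ∘ proj₂) (filterᵇ isDropᵇ (zip (a ∷ t) (t ++ 1 ∷ [])))) → Good a t
  forward a []      h = []
  forward a (b ∷ t) h with b <ᵇ a in eq
  ... | true  = (λ _ → proj₁ (∧⁻ h)) ∷ forward b t (proj₂ (∧⁻ {oddᵇ b} h))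
  ... | false = (λ b<a → ⊥-elim (subst T eq (ℕₚ.<⇒<ᵇ b<a))) ∷ forward b t h
  backward : ∀ a t → Good a t → T (allᵇ (oddᵇ ∘ proj₂) (filterᵇ isDropᵇ (zip (a ∷ t) (t ++ 1 ∷ []))))
  backward a [] [] with 1 <ᵇ a
  ... | true  = tt
  ... | false = tt
  backward a (b ∷ t) (p ∷ ps) with b <ᵇ a in eq
  ... | true  = ∧⁺ (p (ℕₚ.<ᵇ⇒< b a (from T-≡ eq))) (backward b t ps)
  ... | false = backward b t ps

ι : Bool → ℕ
ι b = if b then 1 else 0

ooᵇ : ℕ → ℕ → Bool
ooᵇ a b = (b <ᵇ a) ∧ (oddᵇ a ∧ oddᵇ b)

-- The clause for the empty word is the closing pair into 1, which can be an odd-odd drop although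
-- it never obstructs `Good`.
ooDrops : ℕ → List ℕ → ℕ
ooDrops a []      = ι (ooᵇ a 1)
ooDrops a (b ∷ t) = ι (ooᵇ a b) +ℕ ooDrops b t

length-filterᵇ² : ∀ {A : Set} (p q : A → Bool) x xs →
  length (filterᵇ q (filterᵇ p (x ∷ xs))) ≡ ι (p x ∧ q x) +ℕ length (filterᵇ q (filterᵇ p xs))
length-filterᵇ² p q x xs with p x
... | false = refl
... | true with q x
...   | false = refl
...   | true  = refl

dropOO≡ooDrops : ∀ t → dropOO (1 ∷ t) ≡ ooDrops 1 t
dropOO≡ooDrops = path 1
  where
  bothOddᵇ : ℕ × ℕ → Bool
  bothOddᵇ (a , b) = oddᵇ a ∧ oddᵇ b
  path : ∀ a t → length (filterᵇ bothOddᵇ (filterᵇ isDropᵇ (zip (a ∷ t) (t ++ 1 ∷ [])))) ≡ ooDrops a t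
  path a []      = trans (length-filterᵇ² isDropᵇ bothOddᵇ (a , 1) []) (ℕₚ.+-identityʳ _)
  path a (b ∷ t) = trans (length-filterᵇ² isDropᵇ bothOddᵇ (a , b) (zip (b ∷ t) (t ++ 1 ∷ [])))
    (cong (ι (ooᵇ a b) +ℕ_) (path b t))

-- The end of the word is the place in front of the odd letter 1 that closes the cycle, hence always
-- available.
insertions : ℕ → List ℕ → List (List ℕ)
insertions N []      = (N ∷ []) ∷ []
insertions N (b ∷ t) = (if oddᵇ b then (N ∷ b ∷ t) ∷ [] else []) ++ map (b ∷_) (insertions N t)

-- The words t with 1 ∷ t representing an element of 𝔠ₙ₊₁ᵒ.
tails : ℕ → List (List ℕ)
tails zero    = [] ∷ []
tails (suc n) = concatMap (insertions (suc (suc n))) (tails n)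

data Insertion (N : ℕ) : List ℕ → List ℕ → Set where
  atEnd     : Insertion N [] (N ∷ [])
  beforeOdd : ∀ {b t} → T (oddᵇ b) → Insertion N (b ∷ t) (N ∷ b ∷ t)
  later     : ∀ {b t u} → Insertion N t u → Insertion N (b ∷ t) (b ∷ u)

∈-insertions⁻ : ∀ {N} t {u} → u ∈ insertions N t → Insertion N t u
∈-insertions⁻ []      (here refl) = atEnd
∈-insertions⁻ {N} (b ∷ t) u∈ with oddᵇ b in eq
∈-insertions⁻ {N} (b ∷ t) (here refl) | true = beforeOdd (from T-≡ eq)
∈-insertions⁻ {N} (b ∷ t) (there u∈)  | true with _ , v∈ , refl ← ∈-map⁻ (b ∷_) u∈ = later (∈-insertions⁻ t v∈)
∈-insertions⁻ {N} (b ∷ t) u∈          | false with _ , v∈ , refl ← ∈-map⁻ (b ∷_) u∈ = later (∈-insertions⁻ t v∈)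

∈-insertions⁺ : ∀ {N t u} → Insertion N t u → u ∈ insertions N t
∈-insertions⁺ atEnd = here refl
∈-insertions⁺ {t = b ∷ t} (beforeOdd o) with oddᵇ b
... | true = here refl
∈-insertions⁺ {t = b ∷ t} (later i) = ∈-++⁺ʳ (if oddᵇ b then _ else []) (∈-map⁺ (b ∷_) (∈-insertions⁺ i))

module _ {N : ℕ} where

  Insertion-length : ∀ {t u} → Insertion N t u → length u ≡ suc (length t)
  Insertion-length atEnd         = refl
  Insertion-length (beforeOdd _) = refl
  Insertion-length (later i)     = cong suc (Insertion-length i)

  Insertion-All : ∀ {P : ℕ → Set} {t u} → Insertion N t u → P N → All P t → All P u
  Insertion-All atEnd         p []       = p ∷ []
  Insertion-All (beforeOdd _) p ps       = p ∷ ps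
  Insertion-All (later i)     p (q ∷ qs) = q ∷ Insertion-All i p qs

  Insertion-∈ : ∀ {t u} → Insertion N t u → N ∈ u
  Insertion-∈ atEnd         = here refl
  Insertion-∈ (beforeOdd _) = here refl
  Insertion-∈ (later i)     = there (Insertion-∈ i)

  Insertion-⊆ : ∀ {t u v} → Insertion N t u → v ∈ t → v ∈ u
  Insertion-⊆ (beforeOdd _) v∈         = there v∈
  Insertion-⊆ (later i)     (here e)   = here e
  Insertion-⊆ (later i)     (there v∈) = there (Insertion-⊆ i v∈)

  Insertion-Good : ∀ {a t u} → Insertion N t u → a < N → All (_< N) t → Good a t → Good a u
  Insertion-Good atEnd         a<N _          []       = (λ N<a → ⊥-elim (ℕₚ.<-asym a<N N<a)) ∷ []
  Insertion-Good (beforeOdd o) a<N _          (_ ∷ g)  = (λ N<a → ⊥-elim (ℕₚ.<-asym a<N N<a)) ∷ (λ _ → o) ∷ g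
  Insertion-Good (later i)     a<N (b<N ∷ t<N) (p ∷ g) = p ∷ Insertion-Good i b<N t<N g

  -- The letter b after N is smaller, so the drop from N forces b to be odd. This one fact both
  -- admits the pair that closes the gap and licenses the insertion that undoes the removal.
  Good-remove : ∀ {a} ys {zs} → All (_< N) zs → Good a (ys ++ N ∷ zs) →
                Good a (ys ++ zs) × Insertion N (ys ++ zs) (ys ++ N ∷ zs)
  Good-remove []       []          (_ ∷ [])     = [] , atEnd
  Good-remove []       (b<N ∷ _)   (_ ∷ p ∷ g)  = (λ _ → p b<N) ∷ g , beforeOdd (p b<N)
  Good-remove (y ∷ ys) zs<N        (p ∷ g) with g′ , i ← Good-remove ys zs<N g = p ∷ g′ , later i

  -- Recovers the parent of an inserted word, as `concatMap-unique` requires.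
  delete : List ℕ → List ℕ
  delete []      = []
  delete (b ∷ u) = if b ≡ᵇ N then u else b ∷ delete u

  ≡ᵇ-refl : (N ≡ᵇ N) ≡ true
  ≡ᵇ-refl = to T-≡ (ℕₚ.≡⇒≡ᵇ N N refl)

  delete-Insertion : ∀ {t u} → All (_< N) t → Insertion N t u → delete u ≡ t
  delete-Insertion _ atEnd         rewrite ≡ᵇ-refl = refl
  delete-Insertion _ (beforeOdd _) rewrite ≡ᵇ-refl = refl
  delete-Insertion (b<N ∷ t<N) (later {b} i) with b ≡ᵇ N in eq
  ... | true  = ⊥-elim (ℕₚ.<⇒≢ b<N (ℕₚ.≡ᵇ⇒≡ b N (from T-≡ eq)))
  ... | false = cong (b ∷_) (delete-Insertion t<N i)

  insertions-unique : ∀ {t} → All (_< N) t → Unique (insertions N t)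
  insertions-unique []                    = [] ∷ []
  insertions-unique {b ∷ t} (b<N ∷ t<N) with oddᵇ b
  ... | true  = Allₚ.map⁺ (All.tabulate (λ _ e → ℕₚ.<⇒≢ b<N (sym (∷-injectiveˡ e))))
                ∷ map⁺ ∷-injectiveʳ (insertions-unique t<N)
  ... | false = map⁺ ∷-injectiveʳ (insertions-unique t<N)

-- Insertion produces each cycle exactly once

record IsTail (n : ℕ) (t : List ℕ) : Set where
  constructor isTail
  field
    length≡ : length t ≡ n
    complete : ∀ {v} → 2 ≤ v → v ≤ suc n → v ∈ t
    good : Good 1 t

∈-remove : ∀ {v N : ℕ} ys {zs} → v ≢ N → v ∈ ys ++ N ∷ zs → v ∈ ys ++ zs
∈-remove []       v≢N (here e)   = ⊥-elim (v≢N e)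
∈-remove []       v≢N (there v∈) = v∈
∈-remove (y ∷ ys) v≢N (here e)   = here e
∈-remove (y ∷ ys) v≢N (there v∈) = there (∈-remove ys v≢N v∈)

length-remove : ∀ {N : ℕ} ys {zs} → length (ys ++ N ∷ zs) ≡ suc (length (ys ++ zs))
length-remove []       = refl
length-remove (y ∷ ys) = cong suc (length-remove ys)

-- Pigeonhole by induction: n places hold n required letters and have no room for others. Removing
-- one occurrence of the largest lowers n.
complete⇒bounded : ∀ n {t} → length t ≡ n → (∀ {v} → 2 ≤ v → v ≤ suc n → v ∈ t) → All (_≤ suc n) t
complete⇒bounded zero    {[]} refl _ = []
complete⇒bounded (suc n) {t} len com with ys , zs , refl ← ∈-∃++ (com {suc (suc n)} (s≤s (s≤s z≤n)) ℕₚ.≤-refl) =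
  let rest = All.map ℕₚ.m≤n⇒m≤1+n (complete⇒bounded n {ys ++ zs}
        (ℕₚ.suc-injective (trans (sym (length-remove ys)) len))
        (λ 2≤v v≤ → ∈-remove ys (ℕₚ.<⇒≢ (s≤s v≤)) (com 2≤v (ℕₚ.m≤n⇒m≤1+n v≤))))
  in Allₚ.++⁺ (Allₚ.++⁻ˡ ys rest) (ℕₚ.≤-refl ∷ Allₚ.++⁻ʳ ys rest)

IsTail⇒∈tails : ∀ n {t} → IsTail n t → t ∈ tails n
IsTail⇒∈tails zero {[]} _ = here refl
IsTail⇒∈tails (suc n) {t} (isTail len com g)
  with ys , zs , refl ← ∈-∃++ (com {suc (suc n)} (s≤s (s≤s z≤n)) ℕₚ.≤-refl) =
  ∈-concatMap⁺ (insertions (suc (suc n))) (lose (IsTail⇒∈tails n smaller) (∈-insertions⁺ (proj₂ removed)))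
  where
  len′ : length (ys ++ zs) ≡ n
  len′ = ℕₚ.suc-injective (trans (sym (length-remove ys)) len)
  com′ : ∀ {v} → 2 ≤ v → v ≤ suc n → v ∈ ys ++ zs
  com′ 2≤v v≤ = ∈-remove ys (ℕₚ.<⇒≢ (s≤s v≤)) (com 2≤v (ℕₚ.m≤n⇒m≤1+n v≤))
  removed : Good 1 (ys ++ zs) × Insertion (suc (suc n)) (ys ++ zs) (ys ++ suc (suc n) ∷ zs)
  -- All letters left are at most n + 1, so those behind the removed n + 2 lie below it, as
  -- `Good-remove` demands.
  removed = Good-remove ys (Allₚ.++⁻ʳ ys (All.map s≤s (complete⇒bounded n len′ com′))) g
  smaller : IsTail n (ys ++ zs)
  smaller = isTail len′ com′ (proj₁ removed)

-- The range is carried along in the induction: it shows that the next inserted letter exceeds all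
-- others, and later places the word in `words`.
∈tails⇒IsTail : ∀ n {t} → t ∈ tails n → IsTail n t × All (_∈ range (suc n)) t

∈tails⇒< : ∀ n {t} → t ∈ tails n → All (_< suc (suc n)) t
∈tails⇒< n t∈ = All.map (s≤s ∘ proj₂ ∘ ∈-range⁻) (proj₂ (∈tails⇒IsTail n t∈))

∈-tails-suc⁻ : ∀ n {u} → u ∈ tails (suc n) → ∃ λ t → t ∈ tails n × Insertion (suc (suc n)) t u
∈-tails-suc⁻ n u∈ = go (∈-concatMap⁻ (insertions (suc (suc n))) {xs = tails n} u∈)
  where
  go : ∀ {ts} {u} → Any (λ t → u ∈ insertions (suc (suc n)) t) ts → ∃ λ t → t ∈ ts × Insertion (suc (suc n)) t u
  go (here u∈)  = _ , here refl , ∈-insertions⁻ _ u∈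
  go (there a) with t , t∈ , i ← go a = t , there t∈ , i

∈tails⇒IsTail zero (here refl) = isTail refl (λ 2≤v v≤1 → ⊥-elim (ℕₚ.<⇒≱ 2≤v v≤1)) [] , []
∈tails⇒IsTail (suc n) u∈ with t , t∈ , i ← ∈-tails-suc⁻ n u∈
  with isTail len com g , t∈range ← ∈tails⇒IsTail n t∈ =
  isTail (trans (Insertion-length i) (cong suc len))
    (λ 2≤v v≤ → contains 2≤v (ℕₚ.m≤n⇒m<n∨m≡n v≤))
    (Insertion-Good i (s≤s (s≤s z≤n)) (∈tails⇒< n t∈) g)
  , Insertion-All i (∈-range⁺ (s≤s z≤n) ℕₚ.≤-refl)
      (All.map (λ v∈ → ∈-range⁺ (proj₁ (∈-range⁻ v∈)) (ℕₚ.m≤n⇒m≤1+n (proj₂ (∈-range⁻ v∈)))) t∈range)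
  where
  contains : ∀ {v} → 2 ≤ v → v < suc (suc n) ⊎ v ≡ suc (suc n) → v ∈ _
  contains 2≤v (inj₁ v<)   = Insertion-⊆ i (com 2≤v (s≤s⁻¹ v<))
  contains 2≤v (inj₂ refl) = Insertion-∈ i

tails-unique : ∀ n → Unique (tails n)
tails-unique zero    = [] ∷ []
tails-unique (suc n) = concatMap-unique (delete {suc (suc n)}) (tails-unique n)
  (λ t∈ → insertions-unique (∈tails⇒< n t∈))
  (λ {t} t∈ u∈ → delete-Insertion (∈tails⇒< n t∈) (∈-insertions⁻ t u∈))

-- From cycle representatives to words without the leading 1

cycleRep⁻ : ∀ n {w} → w ∈ cycleReps (suc n) → T (inCoᵇ w) → ∃ λ t → t ∈ tails n × w ≡ 1 ∷ t
cycleRep⁻ n {w} w∈ co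
  with w∈words , p ← ∈-filter⁻ (λ w → T? (startsWith1ᵇ w ∧ isPermᵇ (suc n) w)) {xs = words (suc n) (suc n)} w∈
  with len ← ∈-words-length (suc n) w∈words
  with starts , perm ← ∧⁻ {startsWith1ᵇ w} p = go w len starts perm co
  where
  go : ∀ w → length w ≡ suc n → T (startsWith1ᵇ w) → T (isPermᵇ (suc n) w) → T (inCoᵇ w) → ∃ λ t → t ∈ tails n × w ≡ 1 ∷ t
  go (a ∷ t) len starts perm co with refl ← ℕₚ.≡ᵇ⇒≡ a 1 starts =
    t , IsTail⇒∈tails n (isTail (ℕₚ.suc-injective len) contains (to (inCoᵇ⇔Good t) co)) , refl
    where
    contains : ∀ {v} → 2 ≤ v → v ≤ suc n → v ∈ t
    contains {v} 2≤v v≤ with elemᵇ⁻ v (1 ∷ t) (allᵇ⁻ (λ v → elemᵇ v (1 ∷ t)) perm (∈-range⁺ (ℕₚ.<⇒≤ 2≤v) v≤))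
    ... | here refl = ⊥-elim (ℕₚ.<-irrefl refl 2≤v)
    ... | there v∈  = v∈

cycleRep⁺ : ∀ n {t} → t ∈ tails n → (1 ∷ t) ∈ cycleReps (suc n) × T (inCoᵇ (1 ∷ t))
cycleRep⁺ n {t} t∈ with isTail len com g , t∈range ← ∈tails⇒IsTail n t∈ =
  ∈-filter⁺ (λ w → T? (startsWith1ᵇ w ∧ isPermᵇ (suc n) w))
    (∈-words⁺ (suc n) (cong suc len) (∈-range⁺ (s≤s z≤n) (s≤s z≤n) ∷ t∈range))
    (allᵇ⁺ (λ v → elemᵇ v (1 ∷ t)) (λ v∈ → elemᵇ⁺ (contains (proj₁ (∈-range⁻ v∈)) (proj₂ (∈-range⁻ v∈)))))
  , from (inCoᵇ⇔Good t) g
  where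
  contains : ∀ {v} → 1 ≤ v → v ≤ suc n → v ∈ 1 ∷ t
  contains 1≤v v≤ with ℕₚ.m≤n⇒m<n∨m≡n 1≤v
  ... | inj₁ 2≤v  = there (com 2≤v v≤)
  ... | inj₂ refl = here refl

-- The lists come in different orders, but duplicate-free lists with the same members are
-- permutations of each other, hence equally long.
lhsSeries-tails : ∀ n i → lhsSeries (suc n) i ≡ + length (filterᵇ (λ t → ooDrops 1 t ≡ᵇ i) (tails n))
lhsSeries-tails n i = cong +_ (trans
  (↭-length (∼bag⇒↭ (unique∧set⇒bag cycles! tails! (mk⇔ forward backward))))
  (length-map (1 ∷_) (filterᵇ (λ t → ooDrops 1 t ≡ᵇ i) (tails n))))
  where
  P : List ℕ → Bool
  P w = inCoᵇ w ∧ (dropOO w ≡ᵇ i)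
  Q : List ℕ → Bool
  Q t = ooDrops 1 t ≡ᵇ i
  cycles! : Unique (filterᵇ P (cycleReps (suc n)))
  cycles! = filter⁺ (T? ∘ P) (filter⁺ (λ w → T? (startsWith1ᵇ w ∧ isPermᵇ (suc n) w)) (words-unique (suc n) (suc n)))
  tails! : Unique (map (1 ∷_) (filterᵇ Q (tails n)))
  tails! = map⁺ ∷-injectiveʳ (filter⁺ (T? ∘ Q) (tails-unique n))
  forward : ∀ {w} → w ∈ filterᵇ P (cycleReps (suc n)) → w ∈ map (1 ∷_) (filterᵇ Q (tails n))
  forward {w} w∈ with w∈reps , p ← ∈-filter⁻ (T? ∘ P) {xs = cycleReps (suc n)} w∈
    with co , q ← ∧⁻ {inCoᵇ w} p with t , t∈ , refl ← cycleRep⁻ n w∈reps co =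
    ∈-map⁺ (1 ∷_) (∈-filter⁺ (T? ∘ Q) t∈ (subst (λ d → T (d ≡ᵇ i)) (dropOO≡ooDrops t) q))
  backward : ∀ {w} → w ∈ map (1 ∷_) (filterᵇ Q (tails n)) → w ∈ filterᵇ P (cycleReps (suc n))
  backward w∈ with t , t∈filter , refl ← ∈-map⁻ (1 ∷_) w∈
    with t∈ , q ← ∈-filter⁻ (T? ∘ Q) {xs = tails n} t∈filter with rep , co ← cycleRep⁺ n t∈ =
    ∈-filter⁺ (T? ∘ P) rep (∧⁺ co (subst (λ d → T (d ≡ᵇ i)) (sym (dropOO≡ooDrops t)) q))

-- Counting odd-odd drops

module _ {A : Set} where

  sumOver : (A → ℤ) → List A → ℤ
  sumOver f []       = + 0
  sumOver f (x ∷ xs) = f x + sumOver f xs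

  sumOver-++ : ∀ f xs ys → sumOver f (xs ++ ys) ≡ sumOver f xs + sumOver f ys
  sumOver-++ f []       ys = sym (ℤₚ.+-identityˡ _)
  sumOver-++ f (x ∷ xs) ys = trans (cong (λ z → f x + z) (sumOver-++ f xs ys)) (sym (ℤₚ.+-assoc (f x) _ _))

  sumOver-cong : ∀ {f g} xs → (∀ {x} → x ∈ xs → f x ≡ g x) → sumOver f xs ≡ sumOver g xs
  sumOver-cong []       e = refl
  sumOver-cong (x ∷ xs) e = cong₂ _+_ (e (here refl)) (sumOver-cong xs (e ∘ there))

  sumOver-linear : ∀ a b f g xs → sumOver (λ x → a * f x + b * g x) xs ≡ a * sumOver f xs + b * sumOver g xs
  sumOver-linear a b f g []       = zeros a b
    where
    zeros : ∀ a b → + 0 ≡ a * + 0 + b * + 0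
    zeros = solve-∀
  sumOver-linear a b f g (x ∷ xs) =
    trans (cong (λ z → a * f x + b * g x + z) (sumOver-linear a b f g xs))
          (regroup a b (f x) (g x) (sumOver f xs) (sumOver g xs))
    where
    regroup : ∀ a b u v s t → a * u + b * v + (a * s + b * t) ≡ a * (u + s) + b * (v + t)
    regroup = solve-∀

  sumOver-zero : ∀ xs → sumOver (λ _ → + 0) xs ≡ + 0
  sumOver-zero []       = refl
  sumOver-zero (x ∷ xs) = trans (ℤₚ.+-identityˡ _) (sumOver-zero xs)

  length-filterᵇ : ∀ (p : A → Bool) xs → + length (filterᵇ p xs) ≡ sumOver (λ x → + ι (p x)) xs
  length-filterᵇ p []       = refl
  length-filterᵇ p (x ∷ xs) with p x
  ... | true  = cong (λ z → + 1 + z) (length-filterᵇ p xs)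
  ... | false = trans (length-filterᵇ p xs) (sym (ℤₚ.+-identityˡ _))

sumOver-map : ∀ {A B : Set} f (g : A → B) xs → sumOver f (map g xs) ≡ sumOver (f ∘ g) xs
sumOver-map f g []       = refl
sumOver-map f g (x ∷ xs) = cong (λ z → f (g x) + z) (sumOver-map f g xs)

sumOver-concatMap : ∀ {A B : Set} f (g : A → List B) xs → sumOver f (concatMap g xs) ≡ sumOver (sumOver f ∘ g) xs
sumOver-concatMap f g []       = refl
sumOver-concatMap f g (x ∷ xs) =
  trans (sumOver-++ f (g x) (concatMap g xs)) (cong (λ z → sumOver f (g x) + z) (sumOver-concatMap f g xs))

oddLetters : List ℕ → ℕ
oddLetters []      = 0
oddLetters (b ∷ t) = ι (oddᵇ b) +ℕ oddLetters t

ooᵇ-ascent : ∀ {a b} → a < b → ooᵇ a b ≡ false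
ooᵇ-ascent {a} {b} a<b = cong (_∧ (oddᵇ a ∧ oddᵇ b)) not-drop
  where
  not-drop : (b <ᵇ a) ≡ false
  not-drop with b <ᵇ a in eq
  ... | true  = ⊥-elim (ℕₚ.<-asym a<b (ℕₚ.<ᵇ⇒< b a (from T-≡ eq)))
  ... | false = refl

ooᵇ-toEven : ∀ a {b} → oddᵇ b ≡ false → ooᵇ a b ≡ false
ooᵇ-toEven a {b} e = trans (cong (λ z → (b <ᵇ a) ∧ (oddᵇ a ∧ z)) e)
  (trans (cong ((b <ᵇ a) ∧_) (∧-zeroʳ (oddᵇ a))) (∧-zeroʳ (b <ᵇ a)))

ooᵇ-descent : ∀ {a b} → b < a → oddᵇ b ≡ true → ooᵇ a b ≡ oddᵇ a
ooᵇ-descent {a} {b} b<a e = trans (cong₂ _∧_ (to T-≡ (ℕₚ.<⇒<ᵇ b<a)) (cong (oddᵇ a ∧_) e)) (∧-identityʳ (oddᵇ a))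

-- Among the positions available for N, those destroying an odd-odd drop number
-- d = ooDrops a t; each insertion creates one odd-odd drop iff N is odd.
sumOver-insertions : ∀ {N} (f : ℕ → ℤ) a t → 1 < N → a < N → All (_< N) t →
  sumOver (f ∘ ooDrops a) (insertions N t)
    ≡ + ooDrops a t * f (ι (oddᵇ N) +ℕ pred (ooDrops a t))
      + (+ suc (oddLetters t) - + ooDrops a t) * f (ι (oddᵇ N) +ℕ ooDrops a t)
sumOver-insertions {N} f a [] 1<N a<N [] =
  trans (cong (λ d → f d + + 0) only) (split (ooᵇ a 1))
  where
  ε = ι (oddᵇ N)
  only : ι (ooᵇ a N) +ℕ ι (ooᵇ N 1) ≡ ε
  only = cong₂ (λ x y → ι x +ℕ ι y) (ooᵇ-ascent a<N) (ooᵇ-descent 1<N refl)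
  first : ∀ x y → x + + 0 ≡ + 1 * x + (+ 1 - + 1) * y
  first = solve-∀
  second : ∀ x → x + + 0 ≡ + 0 * x + (+ 1 - + 0) * x
  second = solve-∀
  -- Only the place at the end remains; it destroys the closing pair from a to 1, which `o` records
  -- as odd-odd or not.
  split : ∀ o → f ε + + 0 ≡ + ι o * f (ε +ℕ pred (ι o)) + (+ 1 - + ι o) * f (ε +ℕ ι o)
  split true  = trans (cong (λ e → f e + + 0) (sym (ℕₚ.+-identityʳ ε))) (first (f (ε +ℕ 0)) (f (ε +ℕ 1)))
  split false = trans (cong (λ e → f e + + 0) (sym (ℕₚ.+-identityʳ ε))) (second (f (ε +ℕ 0)))
sumOver-insertions {N} f a (b ∷ t) 1<N a<N (b<N ∷ t<N) = byParity (oddᵇ b) refl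
  where
  open ≡-Reasoning
  ε = ι (oddᵇ N)
  d = ooDrops b t
  k = suc (oddLetters t)
  Claim : ℕ → ℕ → Set
  Claim e l = sumOver (f ∘ ooDrops a) (insertions N (b ∷ t))
    ≡ + e * f (ε +ℕ pred e) + (+ l - + e) * f (ε +ℕ e)

  laterSum : ∀ δ → ι (ooᵇ a b) ≡ δ → sumOver (f ∘ ooDrops a) (map (b ∷_) (insertions N t))
    ≡ + d * f (δ +ℕ (ε +ℕ pred d)) + (+ k - + d) * f (δ +ℕ (ε +ℕ d))
  -- The pair from a to b stays and adds δ to every count. Absorbing δ into the test function is the
  -- reason for an arbitrary `f`.
  laterSum δ refl = trans (sumOver-map (f ∘ ooDrops a) (b ∷_) (insertions N t))
    (sumOver-insertions (f ∘ (δ +ℕ_)) b t 1<N b<N t<N)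

  insertionsEven : oddᵇ b ≡ false → insertions N (b ∷ t) ≡ map (b ∷_) (insertions N t)
  insertionsEven e rewrite e = refl

  insertionsOdd : oddᵇ b ≡ true → insertions N (b ∷ t) ≡ (N ∷ b ∷ t) ∷ map (b ∷_) (insertions N t)
  insertionsOdd e rewrite e = refl

  first : oddᵇ b ≡ true → ooDrops a (N ∷ b ∷ t) ≡ ε +ℕ d
  first e = cong₂ (λ x y → ι x +ℕ (ι y +ℕ d)) (ooᵇ-ascent a<N) (ooᵇ-descent b<N e)

  -- pred d is junk exactly when its coefficient d vanishes
  shiftPred : ∀ d → + d * f (suc (ε +ℕ pred d)) ≡ + d * f (ε +ℕ d)
  shiftPred zero    = refl
  shiftPred (suc d) = cong (λ e → + suc d * f e) (sym (ℕₚ.+-suc ε d))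

  gained : ∀ x y d k → x + (d * x + (k - d) * y) ≡ (+ 1 + d) * x + ((+ 1 + k) - (+ 1 + d)) * y
  gained = solve-∀
  kept : ∀ x y d k → x + (d * y + (k - d) * x) ≡ d * y + ((+ 1 + k) - d) * x
  kept = solve-∀

  odd : ∀ o → ooᵇ a b ≡ o → oddᵇ b ≡ true → Claim (ι o +ℕ d) (suc k)
  odd o eo e = begin
    sumOver (f ∘ ooDrops a) (insertions N (b ∷ t))
      ≡⟨ cong (sumOver (f ∘ ooDrops a)) (insertionsOdd e) ⟩
    f (ooDrops a (N ∷ b ∷ t)) + sumOver (f ∘ ooDrops a) (map (b ∷_) (insertions N t))
      ≡⟨ cong₂ _+_ (cong f (first e)) (laterSum (ι o) (cong ι eo)) ⟩
    f (ε +ℕ d) + (+ d * f (ι o +ℕ (ε +ℕ pred d)) + (+ k - + d) * f (ι o +ℕ (ε +ℕ d)))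
      ≡⟨ combine o ⟩
    + (ι o +ℕ d) * f (ε +ℕ pred (ι o +ℕ d)) + (+ suc k - + (ι o +ℕ d)) * f (ε +ℕ (ι o +ℕ d)) ∎
    where
    combine : ∀ o → f (ε +ℕ d) + (+ d * f (ι o +ℕ (ε +ℕ pred d)) + (+ k - + d) * f (ι o +ℕ (ε +ℕ d)))
      ≡ + (ι o +ℕ d) * f (ε +ℕ pred (ι o +ℕ d)) + (+ suc k - + (ι o +ℕ d)) * f (ε +ℕ (ι o +ℕ d))
    -- The place before b joins the k - d harmless ones if the pair from a to b is not odd-odd, and
    -- the d destructive ones if it is.
    combine false = kept (f (ε +ℕ d)) (f (ε +ℕ pred d)) (+ d) (+ k)
    combine true  = begin
      f (ε +ℕ d) + (+ d * f (suc (ε +ℕ pred d)) + (+ k - + d) * f (suc (ε +ℕ d)))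
        ≡⟨ cong₂ (λ x y → f (ε +ℕ d) + (x + (+ k - + d) * f y)) (shiftPred d) (sym (ℕₚ.+-suc ε d)) ⟩
      f (ε +ℕ d) + (+ d * f (ε +ℕ d) + (+ k - + d) * f (ε +ℕ suc d))
        ≡⟨ gained (f (ε +ℕ d)) (f (ε +ℕ suc d)) (+ d) (+ k) ⟩
      + suc d * f (ε +ℕ d) + (+ suc k - + suc d) * f (ε +ℕ suc d) ∎

  byParity : ∀ o → oddᵇ b ≡ o → Claim (ι (ooᵇ a b) +ℕ d) (suc (ι (oddᵇ b) +ℕ oddLetters t))
  byParity true e = subst (λ l → Claim (ι (ooᵇ a b) +ℕ d) (suc (ι l +ℕ oddLetters t))) (sym e) (odd (ooᵇ a b) refl e)
  byParity false e = subst (λ l → Claim (ι (ooᵇ a b) +ℕ d) (suc (ι l +ℕ oddLetters t))) (sym e)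
    (subst (λ o → Claim (ι o +ℕ d) k) (sym (ooᵇ-toEven a e))
      (trans (cong (sumOver (f ∘ ooDrops a)) (insertionsEven e)) (laterSum 0 (cong ι (ooᵇ-toEven a e)))))

Insertion-oddLetters : ∀ {N t u} → Insertion N t u → oddLetters u ≡ ι (oddᵇ N) +ℕ oddLetters t
Insertion-oddLetters atEnd         = refl
Insertion-oddLetters (beforeOdd _) = refl
Insertion-oddLetters {N} (later {b} {t} i) = trans (cong (ι (oddᵇ b) +ℕ_) (Insertion-oddLetters i))
  (x∙yz≈y∙xz (ι (oddᵇ b)) (ι (oddᵇ N)) (oddLetters t))
  where open CommutativeSemigroupProperties ℕₚ.+-commutativeSemigroup using (x∙yz≈y∙xz)

oddᵇ-double : ∀ q → oddᵇ (double q) ≡ false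
oddᵇ-double zero    = refl
oddᵇ-double (suc q) = oddᵇ-double q

oddᵇ-suc-double : ∀ q → oddᵇ (suc (double q)) ≡ true
oddᵇ-suc-double zero    = refl
oddᵇ-suc-double (suc q) = oddᵇ-suc-double q

-- The letters run from 2 to 2p + 1 or to 2p + 2; the odd ones are 3, 5, ..., 2p + 1 in both cases.
-- The leading 1 makes them p + 1, the parameter of `D` in both recurrences.
oddLetters-even : ∀ p {t} → t ∈ tails (double p) → oddLetters t ≡ p
oddLetters-odd : ∀ p {t} → t ∈ tails (suc (double p)) → oddLetters t ≡ p
oddLetters-even zero (here refl) = refl
oddLetters-even (suc p) u∈ with t , t∈ , i ← ∈-tails-suc⁻ (suc (double p)) u∈ =
  trans (Insertion-oddLetters i) (cong₂ (λ o l → ι o +ℕ l) (oddᵇ-suc-double p) (oddLetters-odd p t∈))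
oddLetters-odd p u∈ with t , t∈ , i ← ∈-tails-suc⁻ (double p) u∈ =
  trans (Insertion-oddLetters i) (cong₂ (λ o l → ι o +ℕ l) (oddᵇ-double p) (oddLetters-even p t∈))

-- Recurrences for the drop enumerators

χ : ℕ → ℕ → ℤ
χ i d = + ι (d ≡ᵇ i)

count : ℕ → Poly
count n i = sumOver (χ i ∘ ooDrops 1) (tails n)

lhsSeries-count : ∀ n i → lhsSeries (suc n) i ≡ count n i
lhsSeries-count n i = trans (lhsSeries-tails n i) (length-filterᵇ (λ t → ooDrops 1 t ≡ᵇ i) (tails n))

χ-* : ∀ (f : ℕ → ℤ) i d → f d * χ i d ≡ f i * χ i d
χ-* f i d with d ≡ᵇ i in eq
... | true  = cong (λ j → f j * + 1) (ℕₚ.≡ᵇ⇒≡ d i (from T-≡ eq))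
... | false = trans (ℤₚ.*-zeroʳ (f d)) (sym (ℤₚ.*-zeroʳ (f i)))

-- The derivative seen on coefficients: destroying one of d drops sends x^d to d x^(d-1). For d = 0
-- the factor d cancels the meaningless predecessor.
χ-pred : ∀ i d → + d * χ i (pred d) ≡ + suc i * χ (suc i) d
χ-pred i zero    = sym (ℤₚ.*-zeroʳ (+ suc i))
χ-pred i (suc d) = χ-* (λ j → + suc j) i d

module _ (K n : ℕ) (oddLetters-tails : ∀ {t} → t ∈ tails n → suc (oddLetters t) ≡ K) where

  private
    N = suc (suc n)

    -- The coefficient of x^i in D_K x^d = d x^(d-1) + (K - d) x^d.
    destroyed : ℕ → ℕ → ℤ
    destroyed i d = + d * χ i (pred d) + (+ K - + d) * χ i d

    count-destroyed : ∀ i → sumOver (λ t → destroyed i (ooDrops 1 t)) (tails n) ≡ D (+ K) (count n) i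
    count-destroyed i = trans
      (sumOver-cong (tails n) (λ {t} _ → trans
        (cong₂ _+_ (χ-pred i (ooDrops 1 t)) (χ-* (λ j → + K - + j) i (ooDrops 1 t)))
        (ℤₚ.+-comm (+ suc i * χ (suc i) (ooDrops 1 t)) _)))
      (sumOver-linear (+ K - + i) (+ suc i) (χ i ∘ ooDrops 1) (χ (suc i) ∘ ooDrops 1) (tails n))

    count-suc : ∀ i ε → ι (oddᵇ N) ≡ ε → count (suc n) i ≡ sumOver (λ t →
      + ooDrops 1 t * χ i (ε +ℕ pred (ooDrops 1 t)) + (+ K - + ooDrops 1 t) * χ i (ε +ℕ ooDrops 1 t)) (tails n)
    count-suc i ε refl = trans (sumOver-concatMap (χ i ∘ ooDrops 1) (insertions N) (tails n))
      (sumOver-cong (tails n) (λ {t} t∈ → trans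
        (sumOver-insertions (χ i) 1 t (s≤s (s≤s z≤n)) (s≤s (s≤s z≤n)) (∈tails⇒< n t∈))
        (cong (λ k → + ooDrops 1 t * χ i (ε +ℕ pred (ooDrops 1 t)) + (+ k - + ooDrops 1 t) * χ i (ε +ℕ ooDrops 1 t))
          (oddLetters-tails t∈))))

  count-evenStep : oddᵇ N ≡ false → ∀ i → count (suc n) i ≡ D (+ K) (count n) i
  count-evenStep e i = trans (count-suc i 0 (cong ι e)) (count-destroyed i)

  count-oddStep : oddᵇ N ≡ true → ∀ i → count (suc n) i ≡ xP (D (+ K) (count n)) i
  -- For odd N each insertion creates an odd-odd drop, so the count 0 never occurs and both
  -- indicators vanish.
  count-oddStep e zero    = trans (count-suc 0 1 (cong ι e)) (trans
    (sumOver-cong (tails n) (λ {t} _ → zeros (+ ooDrops 1 t) (+ K - + ooDrops 1 t)))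
    (sumOver-zero (tails n)))
    where
    zeros : ∀ a b → a * + 0 + b * + 0 ≡ + 0
    zeros = solve-∀
  -- `χ (suc i) (suc d)` is `χ i d` by definition: the created drop is the factor x.
  count-oddStep e (suc i) = trans (count-suc (suc i) 1 (cong ι e)) (count-destroyed i)

count≡oddCoefficient : ∀ p i → count (double p) i ≡ oddCoefficient p i
count≡evenCoefficient : ∀ p i → count (suc (double p)) i ≡ evenCoefficient p i
-- Both sides are the constant 1: the cycle on [1] has no odd-odd drop, and the second sum starts
-- with (0!)² t.
count≡oddCoefficient zero i = initial i
  where
  initial : ∀ i → count 0 i ≡ oddCoefficient 0 i
  initial zero          = refl
  initial (suc zero)    = refl
  initial (suc (suc i)) = refl
count≡oddCoefficient (suc p) i = begin
  count (double (suc p)) i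
    ≡⟨ count-oddStep (suc p) (suc (double p)) (cong suc ∘ oddLetters-odd p) (oddᵇ-suc-double (suc p)) i ⟩
  xP (D (+ suc p) (count (suc (double p)))) i
    ≡⟨ xP-cong (D-cong (+ suc p) (count≡evenCoefficient p)) i ⟩
  xP (D (+ suc p) (evenCoefficient p)) i
    ≡⟨ oddCoefficient-step p i ⟨
  oddCoefficient (suc p) i ∎
  where open ≡-Reasoning
count≡evenCoefficient p i = begin
  count (suc (double p)) i
    ≡⟨ count-evenStep (suc p) (double p) (cong suc ∘ oddLetters-even p) (oddᵇ-double (suc p)) i ⟩
  D (+ suc p) (count (double p)) i
    ≡⟨ D-cong (+ suc p) (count≡oddCoefficient p) i ⟩
  D (+ suc p) (oddCoefficient p) i
    ≡⟨ evenCoefficient-step p i ⟨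
  evenCoefficient p i ∎
  where open ≡-Reasoning

-- Conclusion by parity

data Parity : ℕ → Set where
  even : ∀ p → Parity (double p)
  odd  : ∀ p → Parity (suc (double p))

parity : ∀ n → Parity n
parity zero = even 0
parity (suc n) with parity n
... | even p = odd p
... | odd p  = even (suc p)

theorem1p1 : (n i : ℕ) → lhsSeries n i ≡ rhsSeries n i
theorem1p1 zero    i = refl
theorem1p1 (suc n) i with parity n
-- Here n counts the letters after the leading 1, so even n belongs to an odd power of t.
... | even p = trans (lhsSeries-count (double p) i)
  (trans (count≡oddCoefficient p i) (sym (rhsSeries-odd p i)))
... | odd p  = trans (lhsSeries-count (suc (double p)) i)
  (trans (count≡evenCoefficient p i) (sym (rhsSeries-even p i)))
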